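{- Let $a,\ell_1,\ell_2,\ldots,\ell_k$ be positive integers such that $2\leq a\leq \ell_1\leq\ell_2\leq\cdots\leq\ell_k$ and $2^a-a-1\geq k$. Let $\sigma$ be the layered permutation whose layer sequence is $(\underbrace{1,1,\ldots,1}_{a},\ell_1,\ell_2,\ldots,\ell_k)$ (i.e. with block sequence $(\widehat{a},\ell_1,\ldots,\ell_k)$: an antilayer of length $a$ followed by layers of lengths $\ell_1,\ldots,\ell_k$). Then \[ p(\sigma) = \frac{|\sigma|!}{|\sigma|^{|\sigma|}}\,\frac{a^a}{a!}\prod_{i=1}^k\frac{\ell_i^{\ell_i}}{\ell_i!}, \] where $|\sigma| = a+\sum_{i=1}^k\ell_i$.
   Context: A permutation of $[n]=\{1,\ldots,n\}$ is written $(\sigma(1)\sigma(2)\cdots\sigma(n))$ and $|\sigma|=n$; $\mathfrak{S}_n$ is the set of permutations of $[n]$. For $\{i_1<\cdots<i_m\}\subset[n]$, $\sigma[\{i_1,\ldots,i_m\}]$ is the unique $\tau\in\mathfrak{S}_m$ with $\sigma(i_j)<\sigma(i_k)\iff\tau(j)<\tau(k)$. For $\tau\in\mathfrak{S}_m$, $\sigma\in\mathfrak{S}_n$, $m\le n$, the density $p(\tau,\sigma)$ is $\binom{n}{m}^{ -1}$ times the number of $m$-subsets $A\subset[n]$ with $\sigma[A]=\tau$ (and $0$ if $m>n$). The packing density is $p(\tau)=\lim_{N\to\infty}\max\{p(\tau,\sigma):\sigma\in\mathfrak{S}_N\}$ (this limit exists). A permutation is layered with layer sequence $(r_1,\ldots,r_m)$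 (positive integers summing to $n$) if it is the concatenation of $m$ decreasing runs of consecutive values, of lengths $r_1,\ldots,r_m$, with all values in each run smaller than all values in later runs; e.g. layer sequence $(2,1,3)$ gives $(213654)$. An antilayer is a maximal contiguous nonempty sequence of layers of length $1$. -}

module Defs where

open import Data.Nat using (ℕ; zero; suc; _+_; _*_; _∸_; _^_; _<ᵇ_; _≤_)
open import Data.Nat using (_!)
open import Data.Nat.Combinatorics using (_C_)
open import Data.Bool using (Bool; true; false; if_then_else_; _∧_)
open import Data.Bool.Properties using () renaming (_≟_ to _≟ᵇ_)
open import Data.Fin using (Fin; zero; suc; toℕ)
open import Data.Fin.Permutation using (Permutation′; _⟨$⟩ʳ_)
open import Data.List using (List; []; _∷_; _++_; map; replicate; allFin)
open import Data.Bool.ListAction using (and)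
open import Data.Vec using (Vec; []; _∷_; lookup)
import Data.Vec as V
open import Data.Integer using (+_)
open import Data.Rational using (ℚ; 0ℚ; _/_)
open import Relation.Nullary.Decidable using (⌊_⌋)

-- A permutation of [n] is represented by Permutation′ n (a bijection Fin n ↔ Fin n);
-- positions and values are 0-indexed (Fin n), which does not affect order patterns.

-- All m-subsets of [n], represented as strictly increasing m-tuples of positions.
subsets : (m n : ℕ) → List (Vec (Fin n) m)
subsets zero n = [] ∷ []
subsets (suc m) zero = []
subsets (suc m) (suc n) =
  map (λ v → zero ∷ V.map suc v) (subsets m n) ++ map (V.map suc) (subsets (suc m) n)

_==_ : Bool → Bool → Bool
b == c = ⌊ b ≟ᵇ c ⌋

-- σ[A] = τ, where A = {v 0 < v 1 < ... < v (m-1)}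
patternAt : {m n : ℕ} → Permutation′ m → Permutation′ n → Vec (Fin n) m → Bool
patternAt {m} τ σ v =
  and (map (λ j → and (map (λ k →
      (toℕ (σ ⟨$⟩ʳ lookup v j) <ᵇ toℕ (σ ⟨$⟩ʳ lookup v k))
        == (toℕ (τ ⟨$⟩ʳ j) <ᵇ toℕ (τ ⟨$⟩ʳ k))) (allFin m))) (allFin m))

countB : {A : Set} → (A → Bool) → List A → ℕ
countB f [] = 0
countB f (x ∷ xs) = if f x then suc (countB f xs) else countB f xs

-- p/d as a rational, with the convention p/0 = 0
frac : ℕ → ℕ → ℚ
frac p zero = 0ℚ
frac p (suc d) = (+ p) / suc d

-- density p(τ,σ) = (number of m-subsets A with σ[A] = τ) / (n choose m); 0 if m > n
density : {m n : ℕ} → Permutation′ m → Permutation′ n → ℚ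
density {m} {n} τ σ = frac (countB (patternAt τ σ) (subsets m n)) (n C m)

-- The layered permutation with layer sequence rs, as a function on 0-indexed positions:
-- a layer of length r starting at position s maps s+j ↦ s+r-1-j.
layeredFn : List ℕ → ℕ → ℕ
layeredFn [] p = p
layeredFn (r ∷ rs) p = if p <ᵇ r then r ∸ suc p else r + layeredFn rs (p ∸ r)

sumV : {k : ℕ} → Vec ℕ k → ℕ
sumV [] = 0
sumV (x ∷ xs) = x + sumV xs

prodV : {k : ℕ} → Vec ℕ k → ℕ
prodV [] = 1
prodV (x ∷ xs) = x * prodV xs

{-# OPTIONS --safe #-}

module Submission where

open import Defs
open import Data.Bool using (Bool; true; false; if_then_else_; _∧_; not)
open import Data.Bool.ListAction using (and)
open import Data.Bool.Properties using (∧-idem) renaming (_≟_ to _≟ᵇ_)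
open import Data.Empty using (⊥; ⊥-elim)
open import Data.Fin using (Fin; zero; suc; toℕ; fromℕ<) renaming (_≤_ to _≤ᶠ_)
open import Data.Fin.Permutation using (Permutation′; _⟨$⟩ʳ_; _⟨$⟩ˡ_; permutation; inverseˡ)
open import Data.Fin.Properties using (toℕ-injective; toℕ-fromℕ<; toℕ<n)
open import Data.Integer using (+[1+_]; +<+)
import Data.Integer as ℤ
import Data.Integer.Properties as ℤ
open import Data.List using (List; []; _∷_; _++_; length; map; replicate; applyUpTo; allFin; tabulate)
open import Data.List.Membership.Propositional using (_∈_)
open import Data.List.Membership.Propositional.Properties using (∈-++⁺ˡ; ∈-++⁺ʳ; ∈-++⁻; ∈-allFin)
open import Data.List.Properties using (length-++; length-replicate; length-map; length-tabulate)
open import Data.List.Relation.Binary.Permutation.Propositional using (_↭_; prep; swap; ↭-refl; ↭-sym; ↭-trans)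
open import Data.List.Relation.Binary.Permutation.Propositional.Properties using (∈-resp-↭; All-resp-↭; ↭-length; map⁺; ++⁺ˡ; ++⁺ʳ)
open import Data.List.Relation.Unary.All as All using (All; []; _∷_)
open import Data.List.Relation.Unary.All.Properties using () renaming (++⁺ to All-++⁺)
open import Data.List.Relation.Unary.AllPairs using (AllPairs; []; _∷_)
open import Data.List.Relation.Unary.Any using (here; there)
open import Data.Nat using (ℕ; zero; suc; pred; _+_; _*_; _∸_; _^_; _/_; _%_; _!; _≤_; _<_; _≤?_; _<ᵇ_; z≤n; s≤s; NonZero; >-nonZero; >-nonZero⁻¹)
open import Data.Nat.Combinatorics using (_C_; nCk≡nC[n∸k]; nCn≡1; k>n⇒nCk≡0; nCk+nC[k+1]≡[n+1]C[k+1])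
open import Data.Nat.DivMod using (m≡m%n+[m/n]*n; m%n<n)
open import Data.Nat.ListAction using (sum; product)
open import Data.Nat.ListAction.Properties using (sum-++; product-++; sum-↭)
open import Data.Nat.Properties
open import Data.Nat.Tactic.RingSolver using (solve-∀)
open import Data.Product using (Σ; ∃; _×_; _,_; proj₁; proj₂)
open import Data.Rational using (ℚ; 0ℚ; mkℚ; _-_; toℚᵘ; ↧ₙ_) renaming (_+_ to _+ℚ_; _<_ to _<ℚ_; -_ to -ℚ_)
import Data.Rational as ℚ
import Data.Rational.Properties as ℚ
open import Data.Rational.Unnormalised using (mkℚᵘ; *<*)
import Data.Rational.Unnormalised.Properties as ℚᵘ
open import Data.Sum using (_⊎_; inj₁; inj₂; [_,_]′)
open import Data.Vec using (Vec; []; _∷_; lookup; toList)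
import Data.Vec as V
import Data.Vec.Properties as V
open import Function using (_∘_; id)
open import Relation.Binary using (tri<; tri≈; tri>)
open import Relation.Binary.PropositionalEquality using (_≡_; _≢_; refl; sym; trans; cong; cong₂; subst; subst₂; module ≡-Reasoning)
open import Relation.Nullary using (Dec; yes; no; ¬_; does)

-- Order the points of a host permutation by c ≺ d iff c lies to the left of and below d, and give
-- them weights.  If x and y are incomparable and occur in one copy of a layered pattern, they lie in
-- the same layer, so either may replace the other.  Hence moving the whole weight of one of them to
-- the other does not decrease the weighted number of copies, and repeating this leaves a chain, i.e.
-- a layered host with layer sizes v₁, v₂, … .
--
-- For a layered host consisting of an antilayer of mass x followed by layers v₁, v₂, …, the count is
-- an explicit polynomial.  As ℓ is nondecreasing, sorting v does not decrease it.  While there are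
-- more than k layers, one more is removed without loss: if the k largest layers all have size ≥ x,
-- the smallest layer is absorbed into the antilayer; otherwise the k-th largest layer is merged with
-- its predecessor.  Both steps rest on 2^a − a − 1 ≥ k, since Σ_{t≥2} (a choose t) = 2^a − a − 1
-- bounds the terms gained in (x + y)^a.  With exactly k layers left, weighted AM–GM finishes.
-- Blowing up the pattern proportionally shows that the bound is attained in the limit.

-- Counting in a layered host

-- Copies are first bounded by words that may repeat a point within a layer, at the price of the
-- factorials of the layer sizes. Only then is the count homogeneous of degree n in the weights, so
-- that weight can be moved freely and the final bound is a multiple of N^n. The case distinction on
-- x answers an obstacle to absorbing a layer y < x. The selections lost carry the factor x^a,
-- whereas a term gained in (x + y)^a is only known to be at least y^a. If instead the k-th largest
-- layer z is below x, a point of the layer y before it that serves as a singleton can become a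
-- point of the merged layer y + z, because a x^(a-1) z^l ≤ l x^a z^(l-1). The gain then comes from
-- (y + z)^l, and a ≤ l gives 2^l - l - 1 ≥ k.

excess : ℕ → ℕ
excess zero = 0
excess (suc a) = 2 * excess a + a

-- The recursive `excess` avoids truncated subtraction and fits an induction that multiplies by
-- `x + y`: the old terms double, and `a` new quadratic ones arise from the linear term.
excess-2^ : ∀ a → excess a + a + 1 ≡ 2 ^ a
excess-2^ zero = refl
excess-2^ (suc a) = trans (e (excess a) a) (cong (2 *_) (excess-2^ a))
  where
  e : ∀ c a → 2 * c + a + suc a + 1 ≡ 2 * (c + a + 1)
  e = solve-∀

excess-mono : ∀ {a b} → a ≤ b → excess a ≤ excess b
excess-mono z≤n = z≤n
excess-mono (s≤s p) = +-mono-≤ (*-monoʳ-≤ 2 (excess-mono p)) p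

-- Each term of the expansion with at least two factors `y` is at least `m ^ a`, and `excess a` is
-- the number of these terms.
binomial-excess : ∀ a {m x y} → m ≤ x → m ≤ y →
  x ^ a + a * (y * x ^ pred a) + excess a * m ^ a ≤ (x + y) ^ a
binomial-excess zero _ _ = ≤-refl
binomial-excess (suc zero) {m} {x} {y} _ _ = ≤-reflexive (e x y m)
  where
  e : ∀ x y m → x * 1 + 1 * (y * 1) + 0 * (m * 1) ≡ (x + y) * 1
  e = solve-∀
binomial-excess (suc (suc b)) {m} {x} {y} m≤x m≤y = begin
  x * (x * X) + (2 + b) * (y * (x * X)) + (2 * c + suc b) * (m * (m * M))
    ≡⟨ e₁ x X y b c m M ⟩
  x * (x * X) + (2 + b) * (y * (x * X)) + ((m + m) * (c * (m * M)) + suc b * (m * m * M))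
    ≤⟨ +-monoʳ-≤ (x * (x * X) + (2 + b) * (y * (x * X)))
         (+-mono-≤ (*-monoˡ-≤ (c * (m * M)) (+-mono-≤ m≤x m≤y))
                   (*-monoʳ-≤ (suc b) (*-mono-≤ (*-mono-≤ m≤y m≤y) (^-monoˡ-≤ b m≤x)))) ⟩
  x * (x * X) + (2 + b) * (y * (x * X)) + ((x + y) * (c * (m * M)) + suc b * (y * y * X))
    ≡⟨ e₂ x X y b c m M ⟩
  (x + y) * (x * X + suc b * (y * X) + c * (m * M))
    ≤⟨ *-monoʳ-≤ (x + y) (binomial-excess (suc b) m≤x m≤y) ⟩
  (x + y) * (x + y) ^ suc b ∎
  where
  open ≤-Reasoning
  X = x ^ b
  M = m ^ b
  c = excess (suc b)
  e₁ : ∀ x X y b c m M →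
    x * (x * X) + (2 + b) * (y * (x * X)) + (2 * c + suc b) * (m * (m * M)) ≡
    x * (x * X) + (2 + b) * (y * (x * X)) + ((m + m) * (c * (m * M)) + suc b * (m * m * M))
  e₁ = solve-∀
  e₂ : ∀ x X y b c m M →
    x * (x * X) + (2 + b) * (y * (x * X)) + ((x + y) * (c * (m * M)) + suc b * (y * y * X)) ≡
    (x + y) * (x * X + suc b * (y * X) + c * (m * M))
  e₂ = solve-∀

-- Larger exponents belong on larger bases: apart from the common factor `y ^ a * v ^ a`, this is
-- monotonicity of the power `l − a`. It drives both `extend` and the sorting of layers.
^-exchange : ∀ {a l y v} → a ≤ l → y ≤ v → y ^ l * v ^ a ≤ y ^ a * v ^ l
^-exchange {a} {l} {y} {v} a≤l y≤v with m≤n⇒∃[o]m+o≡n a≤l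
... | d , refl = begin
  y ^ (a + d) * v ^ a     ≡⟨ cong (_* v ^ a) (^-distribˡ-+-* y a d) ⟩
  y ^ a * y ^ d * v ^ a   ≤⟨ *-monoˡ-≤ (v ^ a) (*-monoʳ-≤ (y ^ a) (^-monoˡ-≤ d y≤v)) ⟩
  y ^ a * v ^ d * v ^ a   ≡⟨ e (y ^ a) (v ^ d) (v ^ a) ⟩
  y ^ a * (v ^ a * v ^ d) ≡⟨ cong (y ^ a *_) (^-distribˡ-+-* v a d) ⟨
  y ^ a * v ^ (a + d)     ∎
  where
  open ≤-Reasoning
  e : ∀ p q r → p * q * r ≡ p * (r * q)
  e = solve-∀

-- layers (ℓ₁ … ℓₖ) v = Σ_{i₁ < … < iₖ} Π v_{iₛ} ^ ℓₛ: copies of a layered pattern, times Π ℓₛ!.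
layers : List ℕ → List ℕ → ℕ
layers [] vs = 1
layers (l ∷ ls) [] = 0
layers (l ∷ ls) (v ∷ vs) = v ^ l * layers ls vs + layers (l ∷ ls) vs

-- The same for the pattern with a singletons in front, times a!, in a host with an antilayer of mass x
-- in front of the layers vs; a singleton is played either by the antilayer or by an unused layer.
blocks : ℕ → ℕ → List ℕ → List ℕ → ℕ
blocks x a [] [] = x ^ a
blocks x a (l ∷ ls) [] = 0
blocks x a [] (v ∷ vs) = a * (v * blocks x (pred a) [] vs) + blocks x a [] vs
blocks x a (l ∷ ls) (v ∷ vs) =
  x ^ a * (v ^ l * layers ls vs) + (a * (v * blocks x (pred a) (l ∷ ls) vs) + blocks x a (l ∷ ls) vs)

layers-short : ∀ ls vs → length vs < length ls → layers ls vs ≡ 0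
layers-short (l ∷ ls) [] _ = refl
layers-short (l ∷ ls) (v ∷ vs) (s≤s p)
  rewrite layers-short ls vs p | layers-short (l ∷ ls) vs (m≤n⇒m≤1+n p) = trans (+-identityʳ _) (*-zeroʳ (v ^ l))

blocks-short : ∀ x a ls vs → length vs < length ls → blocks x a ls vs ≡ 0
blocks-short x a (l ∷ ls) [] _ = refl
blocks-short x a (l ∷ ls) (v ∷ vs) (s≤s p)
  rewrite layers-short ls vs p | blocks-short x (pred a) (l ∷ ls) vs (m≤n⇒m≤1+n p)
        | blocks-short x a (l ∷ ls) vs (m≤n⇒m≤1+n p) = e (x ^ a) (v ^ l) a v
  where
  e : ∀ p q a v → p * (q * 0) + (a * (v * 0) + 0) ≡ 0
  e = solve-∀

-- Marks `k` entries that are at least `t`, wherever they stand, so that the recursion of `extend`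
-- along the list meets them one by one.
data Top (t : ℕ) : ℕ → List ℕ → Set where
  none : ∀ {V} → Top t 0 V
  take : ∀ {k v V} → t ≤ v → Top t k V → Top t (suc k) (v ∷ V)
  skip : ∀ {k v V} → Top t k V → Top t k (v ∷ V)

Top-pred : ∀ {t k V} → Top t (suc k) V → Top t k V
Top-pred (take _ p) = skip p
Top-pred (skip p) = skip (Top-pred p)

Top-raise : ∀ {s t k V} → All (s ≤_) V → Top t k V → Top s k V
Top-raise _ none = none
Top-raise (s≤v ∷ q) (take _ p) = take s≤v (Top-raise q p)
Top-raise (_ ∷ q) (skip p) = skip (Top-raise q p)

Top-all : ∀ {t k V} → All (t ≤_) V → k ≤ length V → Top t k V
Top-all {k = zero} _ _ = none
Top-all {k = suc k} (p ∷ ps) (s≤s q) = take p (Top-all ps q)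

Top-++ : ∀ {t k W} L → Top t k W → Top t k (L ++ W)
Top-++ [] p = p
Top-++ (_ ∷ L) p = skip (Top-++ L p)

Sorted : List ℕ → Set
Sorted = AllPairs _≤_

-- A choice of k − 1 layers is compared with the k-choices containing it: replacing y and shifting the
-- exponents multiplies the term by at least (t / y) ^ a, and each k-choice is hit at most k times.
extend : ∀ {a y t l ls} V → a ≤ l → All (a ≤_) ls → Sorted (y ∷ V) → y ≤ t →
  Top t (suc (length ls)) V →
  t ^ a * (y ^ l * layers ls V) ≤ suc (length ls) * (y ^ a * layers (l ∷ ls) V)

-- Splits on whether `v` plays the first exponent of `ls`. If so, `extend` for the shorter list,
-- with `v` in the role of `y`, supplies one more layer and leaves `v ^ a`; `^-exchange` then moves
-- the exponent `l` from `y` to `v`.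
extend-head : ∀ {a y t l ls v} V → a ≤ l → All (a ≤_) ls → Sorted (v ∷ V) → y ≤ v →
  Top t (length ls) V →
  t ^ a * (y ^ l * layers ls (v ∷ V)) ≤
  length ls * (y ^ a * v ^ l * layers ls V) + t ^ a * (y ^ l * layers ls V)

extend {a} {y} {t} {l} {ls} (v ∷ V) a≤l a≤ls ((y≤v ∷ _) ∷ sV) y≤t (take t≤v top) = begin
  t ^ a * (y ^ l * layers ls (v ∷ V))
    ≤⟨ extend-head V a≤l a≤ls sV y≤v top ⟩
  k * (A * D₂) + t ^ a * (y ^ l * D₂)
    ≡⟨ cong (k * (A * D₂) +_) (e₁ (t ^ a) (y ^ l) D₂) ⟩
  k * (A * D₂) + (y ^ l * t ^ a) * D₂
    -- Here `v` itself, being at least `t`, is the added layer.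
    ≤⟨ +-monoʳ-≤ (k * (A * D₂)) (*-monoˡ-≤ D₂ (≤-trans (*-monoʳ-≤ (y ^ l) (^-monoˡ-≤ a t≤v)) (^-exchange a≤l y≤v))) ⟩
  k * (A * D₂) + A * D₂
    ≤⟨ m≤m+n _ (suc k * (y ^ a * D₃)) ⟩
  k * (A * D₂) + A * D₂ + suc k * (y ^ a * D₃)
    ≡⟨ e₂ k (y ^ a) (v ^ l) D₂ D₃ ⟩
  suc k * (y ^ a * (v ^ l * D₂ + D₃)) ∎
  where
  open ≤-Reasoning
  k = length ls
  A = y ^ a * v ^ l
  D₂ = layers ls V
  D₃ = layers (l ∷ ls) V
  e₁ : ∀ p q r → p * (q * r) ≡ q * p * r
  e₁ = solve-∀
  e₂ : ∀ k p q D E → k * (p * q * D) + p * q * D + suc k * (p * E) ≡ suc k * (p * (q * D + E))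
  e₂ = solve-∀
extend {a} {y} {t} {l} {ls} (v ∷ V) a≤l a≤ls ((y≤v ∷ yV) ∷ sV@(_ ∷ sV′)) y≤t (skip top) = begin
  t ^ a * (y ^ l * layers ls (v ∷ V))
    ≤⟨ extend-head V a≤l a≤ls sV y≤v (Top-pred top) ⟩
  k * (A * D₂) + t ^ a * (y ^ l * D₂)
    ≤⟨ +-mono-≤ (*-monoˡ-≤ (A * D₂) (n≤1+n k)) (extend V a≤l a≤ls (yV ∷ sV′) y≤t top) ⟩
  suc k * (A * D₂) + suc k * (y ^ a * D₃)
    ≡⟨ e₂ k (y ^ a) (v ^ l) D₂ D₃ ⟩
  suc k * (y ^ a * (v ^ l * D₂ + D₃)) ∎
  where
  open ≤-Reasoning
  k = length ls
  A = y ^ a * v ^ l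
  D₂ = layers ls V
  D₃ = layers (l ∷ ls) V
  e₂ : ∀ k p q D E → suc k * (p * q * D) + suc k * (p * E) ≡ suc k * (p * (q * D + E))
  e₂ = solve-∀

extend-head {ls = []} V _ _ _ _ _ = ≤-refl
extend-head {a} {y} {t} {l} {l′ ∷ ls} {v} V a≤l (a≤l′ ∷ a≤ls) sV@(vV ∷ _) y≤v top = begin
  t ^ a * (y ^ l * (v ^ l′ * D₁ + D₂))
    ≡⟨ e₁ (t ^ a) (y ^ l) (v ^ l′) D₁ D₂ ⟩
  y ^ l * (t ^ a * (v ^ l′ * D₁)) + t ^ a * (y ^ l * D₂)
    ≤⟨ +-monoˡ-≤ _ (*-monoʳ-≤ (y ^ l) inner) ⟩
  y ^ l * (k * (v ^ a * D₂)) + t ^ a * (y ^ l * D₂)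
    ≡⟨ cong (_+ t ^ a * (y ^ l * D₂)) (e₂ (y ^ l) k (v ^ a) D₂) ⟩
  k * (y ^ l * v ^ a * D₂) + t ^ a * (y ^ l * D₂)
    ≤⟨ +-monoˡ-≤ _ (*-monoʳ-≤ k (*-monoˡ-≤ D₂ (^-exchange a≤l y≤v))) ⟩
  k * (y ^ a * v ^ l * D₂) + t ^ a * (y ^ l * D₂) ∎
  where
  open ≤-Reasoning
  k = suc (length ls)
  D₁ = layers ls V
  D₂ = layers (l′ ∷ ls) V
  inner : t ^ a * (v ^ l′ * D₁) ≤ k * (v ^ a * D₂)
  inner with ≤-total v t
  ... | inj₁ v≤t = extend V a≤l′ a≤ls sV v≤t top
  -- The threshold is raised to `v`, which by sortedness still lies below all of `V`.
  ... | inj₂ t≤v = ≤-trans (*-monoˡ-≤ _ (^-monoˡ-≤ a t≤v)) (extend V a≤l′ a≤ls sV ≤-refl (Top-raise vV top))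
  e₁ : ∀ p q r D E → p * (q * (r * D + E)) ≡ q * (p * (r * D)) + p * (q * E)
  e₁ = solve-∀
  e₂ : ∀ p k q D → p * (k * (q * D)) ≡ k * (p * q * D)
  e₂ = solve-∀

-- The first two summands are the terms that survive when y stays a separate layer of singletons;
-- the third is the gain from taking at least two points of y.
absorb : ∀ {m x y} a ls V → m ≤ x → m ≤ y →
  blocks x a ls V + a * (y * blocks x (pred a) ls V) + excess a * (m ^ a * layers ls V) ≤
  blocks (x + y) a ls V
absorb {m} {x} {y} a [] [] m≤x m≤y = begin
  x ^ a + a * (y * x ^ pred a) + excess a * (m ^ a * 1)
    ≡⟨ cong (λ M → x ^ a + a * (y * x ^ pred a) + excess a * M) (*-identityʳ (m ^ a)) ⟩
  x ^ a + a * (y * x ^ pred a) + excess a * m ^ a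
    ≤⟨ binomial-excess a m≤x m≤y ⟩
  (x + y) ^ a ∎
  where open ≤-Reasoning
absorb {m} {x} {y} a (l ∷ ls) [] m≤x m≤y = ≤-reflexive (e a y (excess a) (m ^ a))
  where
  e : ∀ a y c M → a * (y * 0) + c * (M * 0) ≡ 0
  e = solve-∀
absorb {m} {x} {y} a [] (v ∷ V) m≤x m≤y = begin
  a * (v * B₁) + B₀ + a * (y * (pred a * (v * B₂) + B₁)) + excess a * (m ^ a * 1)
    ≡⟨ e a v B₁ B₀ y (pred a) B₂ (excess a * (m ^ a * 1)) ⟩
  a * (v * (B₁ + pred a * (y * B₂))) + (B₀ + a * (y * B₁) + excess a * (m ^ a * 1))
    ≤⟨ +-mono-≤ (*-monoʳ-≤ a (*-monoʳ-≤ v (m+n≤o⇒m≤o _ (absorb (pred a) [] V m≤x m≤y)))) (absorb a [] V m≤x m≤y) ⟩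
  a * (v * blocks (x + y) (pred a) [] V) + blocks (x + y) a [] V ∎
  where
  open ≤-Reasoning
  B₀ = blocks x a [] V
  B₁ = blocks x (pred a) [] V
  B₂ = blocks x (pred (pred a)) [] V
  e : ∀ a v B₁ B₀ y a′ B₂ M → a * (v * B₁) + B₀ + a * (y * (a′ * (v * B₂) + B₁)) + M ≡
    a * (v * (B₁ + a′ * (y * B₂))) + (B₀ + a * (y * B₁) + M)
  e = solve-∀
absorb {m} {x} {y} a (l ∷ ls) (v ∷ V) m≤x m≤y = begin
  X * P + (a * (v * B₁) + B₀) + a * (y * (X′ * P + (pred a * (v * B₂) + B₁))) + c * (M * (P + D))
    ≡⟨ e X P a v B₁ B₀ y X′ (pred a) B₂ c M D ⟩
  (X + a * (y * X′) + c * M) * P +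
  (a * (v * (B₁ + pred a * (y * B₂))) + (B₀ + a * (y * B₁) + c * (M * D)))
    -- The gain splits by the use of `v`: the part `P` is gained in the power of the antilayer, the
    -- part `D` in the recursive call on `V`. The gain from the call with `pred a` is discarded.
    ≤⟨ +-mono-≤ (*-monoˡ-≤ P (binomial-excess a m≤x m≤y))
        (+-mono-≤ (*-monoʳ-≤ a (*-monoʳ-≤ v (m+n≤o⇒m≤o _ (absorb (pred a) (l ∷ ls) V m≤x m≤y))))
                  (absorb a (l ∷ ls) V m≤x m≤y)) ⟩
  (x + y) ^ a * P + (a * (v * blocks (x + y) (pred a) (l ∷ ls) V) + blocks (x + y) a (l ∷ ls) V) ∎
  where
  open ≤-Reasoning
  X = x ^ a
  X′ = x ^ pred a
  P = v ^ l * layers ls V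
  c = excess a
  M = m ^ a
  D = layers (l ∷ ls) V
  B₀ = blocks x a (l ∷ ls) V
  B₁ = blocks x (pred a) (l ∷ ls) V
  B₂ = blocks x (pred (pred a)) (l ∷ ls) V
  e : ∀ X P a v B₁ B₀ y X′ a′ B₂ c M D →
    X * P + (a * (v * B₁) + B₀) + a * (y * (X′ * P + (a′ * (v * B₂) + B₁))) + c * (M * (P + D)) ≡
    (X + a * (y * X′) + c * M) * P + (a * (v * (B₁ + a′ * (y * B₂))) + (B₀ + a * (y * B₁) + c * (M * D)))
  e = solve-∀

-- The case of `extend` with exponent 0 and threshold `y`, where only the number of selections
-- matters.
extend-count : ∀ {y l ls} V → Sorted (y ∷ V) → suc (length ls) ≤ length V →
  y ^ l * layers ls V ≤ suc (length ls) * layers (l ∷ ls) V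
extend-count {y} {l} {ls} V s@(yV ∷ _) p = begin
  y ^ l * layers ls V             ≡⟨ *-identityˡ _ ⟨
  1 * (y ^ l * layers ls V)       ≤⟨ extend {0} {y} {y} {l} {ls} V z≤n (All.universal (λ _ → z≤n) ls) s ≤-refl (Top-all yV p) ⟩
  k * (1 * layers (l ∷ ls) V)     ≡⟨ cong (k *_) (*-identityˡ _) ⟩
  k * layers (l ∷ ls) V           ∎
  where
  open ≤-Reasoning
  k = suc (length ls)

-- Only selections using `y` as the layer `l` are lost. With `m` the smaller of `x` and `y`, they
-- amount to at most `k` times `m ^ a * layers (l ∷ ls) V`, by `extend-count` if `x ≤ y` and by
-- `extend` if `y ≤ x`; `absorb` gains that term `excess a` times.
absorb-head : ∀ {x y} a ls V → All (a ≤_) ls → length ls ≤ excess a → Sorted (y ∷ V) →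
  length ls ≤ length V → Top x (length ls) V →
  blocks x a ls (y ∷ V) ≤ blocks (x + y) a ls V
absorb-head {x} {y} a [] V _ _ _ _ _ = begin
  a * (y * blocks x (pred a) [] V) + blocks x a [] V ≡⟨ +-comm _ (blocks x a [] V) ⟩
  blocks x a [] V + a * (y * blocks x (pred a) [] V) ≤⟨ m+n≤o⇒m≤o _ (absorb {0} a [] V z≤n z≤n) ⟩
  blocks (x + y) a [] V                              ∎
  where open ≤-Reasoning
absorb-head {x} {y} a (l ∷ ls) V (a≤l ∷ a≤ls) k≤c sV k≤V top with ≤-total x y
... | inj₁ x≤y = begin
  x ^ a * (y ^ l * layers ls V) + (G₁ + G₀)
    ≤⟨ +-monoˡ-≤ _ (*-monoʳ-≤ (x ^ a) (≤-trans (extend-count {l = l} V sV k≤V) (*-monoˡ-≤ D k≤c))) ⟩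
  x ^ a * (c * D) + (G₁ + G₀)  ≡⟨ e (x ^ a) c D G₁ G₀ ⟩
  G₀ + G₁ + c * (x ^ a * D)    ≤⟨ absorb a (l ∷ ls) V ≤-refl x≤y ⟩
  blocks (x + y) a (l ∷ ls) V  ∎
  where
  open ≤-Reasoning
  c = excess a
  D = layers (l ∷ ls) V
  G₀ = blocks x a (l ∷ ls) V
  G₁ = a * (y * blocks x (pred a) (l ∷ ls) V)
  e : ∀ X c D p q → X * (c * D) + (p + q) ≡ q + p + c * (X * D)
  e = solve-∀
... | inj₂ y≤x = begin
  x ^ a * (y ^ l * layers ls V) + (G₁ + G₀)
    ≤⟨ +-monoˡ-≤ _ (≤-trans (extend V a≤l a≤ls sV y≤x top) (*-monoˡ-≤ (y ^ a * D) k≤c)) ⟩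
  c * (y ^ a * D) + (G₁ + G₀)  ≡⟨ e (c * (y ^ a * D)) G₁ G₀ ⟩
  G₀ + G₁ + c * (y ^ a * D)    ≤⟨ absorb a (l ∷ ls) V y≤x ≤-refl ⟩
  blocks (x + y) a (l ∷ ls) V  ∎
  where
  open ≤-Reasoning
  c = excess a
  D = layers (l ∷ ls) V
  G₀ = blocks x a (l ∷ ls) V
  G₁ = a * (y * blocks x (pred a) (l ∷ ls) V)
  e : ∀ M p q → M + (p + q) ≡ q + p + M
  e = solve-∀

-- Merging two neighbouring layers

layers-cons≤ : ∀ {z} ls T → Sorted (z ∷ T) → length ls ≤ length T →
  layers ls (z ∷ T) ≤ suc (length ls) * layers ls T
layers-cons≤ [] T _ _ = ≤-refl
layers-cons≤ {z} (l ∷ ls) T s p = begin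
  z ^ l * layers ls T + D ≤⟨ +-monoˡ-≤ D (extend-count {l = l} T s p) ⟩
  suc (length ls) * D + D ≡⟨ +-comm _ D ⟩
  suc (suc (length ls)) * D ∎
  where
  open ≤-Reasoning
  D = layers (l ∷ ls) T

-- The terms of `(y + z) ^ l` with at least two factors `y` pay for the selections in which `y`
-- alone plays `l`. The linear term is kept, because `merge-blocks` spends it on `y` played as a
-- singleton.
pair-bound : ∀ {y z} l ls T → Sorted (y ∷ z ∷ T) → suc (length ls) ≤ excess l → length ls ≤ length T →
  y ^ l * layers ls (z ∷ T) + (l * (y * z ^ pred l) + z ^ l) * layers ls T ≤ (y + z) ^ l * layers ls T
pair-bound {y} {z} l ls T ((y≤z ∷ _) ∷ s) k≤c k≤T = begin
  y ^ l * layers ls (z ∷ T) + (l * (y * z ^ pred l) + z ^ l) * D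
    ≤⟨ +-monoˡ-≤ _ (*-monoʳ-≤ (y ^ l) (≤-trans (layers-cons≤ ls T s k≤T) (*-monoˡ-≤ D k≤c))) ⟩
  y ^ l * (c * D) + (l * (y * z ^ pred l) + z ^ l) * D
    ≡⟨ e (y ^ l) c D (l * (y * z ^ pred l)) (z ^ l) ⟩
  (z ^ l + l * (y * z ^ pred l) + c * y ^ l) * D
    ≤⟨ *-monoˡ-≤ D (binomial-excess l y≤z ≤-refl) ⟩
  (z + y) ^ l * D
    ≡⟨ cong (λ w → w ^ l * D) (+-comm z y) ⟩
  (y + z) ^ l * D ∎
  where
  open ≤-Reasoning
  D = layers ls T
  c = excess l
  e : ∀ Y c D p q → Y * (c * D) + (p + q) * D ≡ (q + p + c * Y) * D
  e = solve-∀

-- `K` stays fixed while `ls` shrinks along `L`, so the bound on `excess` survives the recursion.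
merge-layers : ∀ {y z K} L ls T → Sorted (y ∷ z ∷ T) → All (λ l → K ≤ excess l) ls →
  length ls ≤ K → length ls ≤ suc (length T) →
  layers ls (L ++ y ∷ z ∷ T) ≤ layers ls (L ++ (y + z) ∷ T)
merge-layers L [] T _ _ _ _ = ≤-refl
merge-layers {y} {z} [] (l ∷ ls) T s (K≤c ∷ _) k≤K (s≤s k≤T) = begin
  y ^ l * layers ls (z ∷ T) + (z ^ l * D + D′)
    ≤⟨ +-monoʳ-≤ (y ^ l * layers ls (z ∷ T)) (+-monoˡ-≤ D′ (*-monoˡ-≤ D (m≤n+m (z ^ l) (l * (y * z ^ pred l))))) ⟩
  y ^ l * layers ls (z ∷ T) + ((l * (y * z ^ pred l) + z ^ l) * D + D′)
    ≡⟨ +-assoc (y ^ l * layers ls (z ∷ T)) _ D′ ⟨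
  y ^ l * layers ls (z ∷ T) + (l * (y * z ^ pred l) + z ^ l) * D + D′
    ≤⟨ +-monoˡ-≤ D′ (pair-bound l ls T s (≤-trans k≤K K≤c) k≤T) ⟩
  (y + z) ^ l * D + D′ ∎
  where
  open ≤-Reasoning
  D = layers ls T
  D′ = layers (l ∷ ls) T
merge-layers (v ∷ L) (l ∷ ls) T s cs@(_ ∷ cs′) k≤K k≤T =
  +-mono-≤ (*-monoʳ-≤ (v ^ l) (merge-layers L ls T s cs′ (<⇒≤ k≤K) (<⇒≤ k≤T)))
           (merge-layers L (l ∷ ls) T s cs k≤K k≤T)

-- With no more host layers than pattern layers, none can be skipped or spent on a singleton.
blocks-single : ∀ x a l ls z T → length T ≤ length ls →
  blocks x a (l ∷ ls) (z ∷ T) ≡ x ^ a * (z ^ l * layers ls T)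
blocks-single x a l ls z T eq
  rewrite blocks-short x (pred a) (l ∷ ls) T (s≤s eq)
        | blocks-short x a (l ∷ ls) T (s≤s eq) = e (x ^ a * (z ^ l * layers ls T)) a z
  where
  e : ∀ p a z → p + (a * (z * 0) + 0) ≡ p
  e = solve-∀

-- Turns `y` as a singleton into one point of the merged layer: a factor `z` is exchanged for `x`,
-- and the multiplicity `a` for `l`. This is where the k-th largest layer must not exceed the
-- antilayer.
singleton-trade : ∀ {x z} a l y → z ≤ x → a ≤ l →
  a * (y * (x ^ pred a * z ^ l)) ≤ x ^ a * (l * (y * z ^ pred l))
singleton-trade zero l y _ _ = z≤n
singleton-trade {x} {z} (suc a) (suc l) y z≤x a≤l = begin
  suc a * (y * (x ^ a * (z * z ^ l))) ≤⟨ *-mono-≤ a≤l (*-monoʳ-≤ y (*-monoʳ-≤ (x ^ a) (*-monoˡ-≤ (z ^ l) z≤x))) ⟩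
  suc l * (y * (x ^ a * (x * z ^ l))) ≡⟨ e (suc l) y (x ^ a) x (z ^ l) ⟩
  x * x ^ a * (suc l * (y * z ^ l))   ∎
  where
  open ≤-Reasoning
  e : ∀ l y X x Z → l * (y * (X * (x * Z))) ≡ x * X * (l * (y * Z))
  e = solve-∀

-- As `z ∷ T` has exactly as many layers as the pattern, all of them are forced once `y` is skipped
-- or spent on a singleton, and `pair-bound` applies after `singleton-trade`.
merge-blocks : ∀ {x y z K} a L l ls T → Sorted (y ∷ z ∷ T) → z ≤ x → a ≤ l →
  All (λ l → K ≤ excess l) (l ∷ ls) → suc (length ls) ≤ K → length T ≡ length ls →
  blocks x a (l ∷ ls) (L ++ y ∷ z ∷ T) ≤ blocks x a (l ∷ ls) (L ++ (y + z) ∷ T)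
merge-blocks {x} {y} {z} a [] l ls T s z≤x a≤l (K≤c ∷ _) k≤K eq = begin
  X * (y ^ l * layers ls (z ∷ T)) + (a * (y * blocks x (pred a) (l ∷ ls) (z ∷ T)) + blocks x a (l ∷ ls) (z ∷ T))
    ≡⟨ cong (X * (y ^ l * layers ls (z ∷ T)) +_)
         (cong₂ (λ p q → a * (y * p) + q) (blocks-single x (pred a) l ls z T (≤-reflexive eq)) (blocks-single x a l ls z T (≤-reflexive eq))) ⟩
  X * (y ^ l * layers ls (z ∷ T)) + (a * (y * (x ^ pred a * (Z * D))) + X * (Z * D))
    ≡⟨ e₁ X (y ^ l * layers ls (z ∷ T)) a y (x ^ pred a) Z D ⟩
  X * (y ^ l * layers ls (z ∷ T)) + (a * (y * (x ^ pred a * Z)) * D + X * (Z * D))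
    ≤⟨ +-monoʳ-≤ (X * (y ^ l * layers ls (z ∷ T))) (+-monoˡ-≤ (X * (Z * D)) (*-monoˡ-≤ D (singleton-trade a l y z≤x a≤l))) ⟩
  X * (y ^ l * layers ls (z ∷ T)) + (X * (l * (y * z ^ pred l)) * D + X * (Z * D))
    ≡⟨ e₂ X (y ^ l * layers ls (z ∷ T)) (l * (y * z ^ pred l)) Z D ⟩
  X * (y ^ l * layers ls (z ∷ T) + (l * (y * z ^ pred l) + Z) * D)
    ≤⟨ *-monoʳ-≤ X (pair-bound l ls T s (≤-trans k≤K K≤c) (≤-reflexive (sym eq))) ⟩
  X * ((y + z) ^ l * D)
    ≡⟨ blocks-single x a l ls (y + z) T (≤-reflexive eq) ⟨
  blocks x a (l ∷ ls) ((y + z) ∷ T) ∎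
  where
  open ≤-Reasoning
  X = x ^ a
  Z = z ^ l
  D = layers ls T
  e₁ : ∀ X p a y X′ Z D → X * p + (a * (y * (X′ * (Z * D))) + X * (Z * D)) ≡ X * p + (a * (y * (X′ * Z)) * D + X * (Z * D))
  e₁ = solve-∀
  e₂ : ∀ X p q Z D → X * p + (X * q * D + X * (Z * D)) ≡ X * (p + (q + Z) * D)
  e₂ = solve-∀
merge-blocks {x} a (v ∷ L) l ls T s z≤x a≤l cs@(_ ∷ cs′) k≤K eq =
  +-mono-≤ (*-monoʳ-≤ (x ^ a) (*-monoʳ-≤ (v ^ l) (merge-layers L ls T s cs′ (<⇒≤ k≤K) (m≤n⇒m≤1+n (≤-reflexive (sym eq))))))
    (+-mono-≤ (*-monoʳ-≤ a (*-monoʳ-≤ v (merge-blocks (pred a) L l ls T s z≤x (≤-trans pred[n]≤n a≤l) cs k≤K eq)))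
              (merge-blocks a L l ls T s z≤x a≤l cs k≤K eq))

-- Sorting the layers, merging them, and the final AM–GM estimate

-- Quantifying over all ls makes the relation a congruence for _∷_.
record _≼_ (vs ws : List ℕ) : Set where
  constructor dominated
  field
    layers-≤ : ∀ {ls} → Sorted ls → All (1 ≤_) ls → layers ls vs ≤ layers ls ws
    blocks-≤ : ∀ {ls} → Sorted ls → All (1 ≤_) ls → ∀ x a → blocks x a ls vs ≤ blocks x a ls ws
open _≼_

≼-refl : ∀ {vs} → vs ≼ vs
≼-refl = dominated (λ _ _ → ≤-refl) (λ _ _ _ _ → ≤-refl)

≼-trans : ∀ {us vs ws} → us ≼ vs → vs ≼ ws → us ≼ ws
≼-trans p q = dominated
  (λ s o → ≤-trans (layers-≤ p s o) (layers-≤ q s o))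
  (λ s o x a → ≤-trans (blocks-≤ p s o x a) (blocks-≤ q s o x a))

≼-cons : ∀ {vs ws} v → vs ≼ ws → (v ∷ vs) ≼ (v ∷ ws)
≼-cons {vs} {ws} v p = dominated lay blo
  where
  lay : ∀ {ls} → Sorted ls → All (1 ≤_) ls → layers ls (v ∷ vs) ≤ layers ls (v ∷ ws)
  lay {[]} _ _ = ≤-refl
  lay {l ∷ ls} s@(_ ∷ s′) o@(_ ∷ o′) = +-mono-≤ (*-monoʳ-≤ (v ^ l) (layers-≤ p s′ o′)) (layers-≤ p s o)
  blo : ∀ {ls} → Sorted ls → All (1 ≤_) ls → ∀ x a → blocks x a ls (v ∷ vs) ≤ blocks x a ls (v ∷ ws)
  blo {[]} s o x a = +-mono-≤ (*-monoʳ-≤ a (*-monoʳ-≤ v (blocks-≤ p s o x (pred a)))) (blocks-≤ p s o x a)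
  blo {l ∷ ls} s@(_ ∷ s′) o@(_ ∷ o′) x a =
    +-mono-≤ (*-monoʳ-≤ (x ^ a) (*-monoʳ-≤ (v ^ l) (layers-≤ p s′ o′)))
      (+-mono-≤ (*-monoʳ-≤ a (*-monoʳ-≤ v (blocks-≤ p s o x (pred a)))) (blocks-≤ p s o x a))

-- The two sides differ only in the terms that use both `u` and `v`, with exponents `l ≤ m`; there
-- `^-exchange` decides.
layers-swap-head : ∀ {u v} l ls R → v ≤ u → All (l ≤_) ls →
  u ^ l * layers ls (v ∷ R) + v ^ l * layers ls R ≤ v ^ l * layers ls (u ∷ R) + u ^ l * layers ls R
layers-swap-head {u} {v} l [] R _ _ = ≤-reflexive (+-comm (u ^ l * 1) (v ^ l * 1))
layers-swap-head {u} {v} l (m ∷ ls) R v≤u (l≤m ∷ _) = begin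
  u ^ l * (v ^ m * A + B) + v ^ l * B         ≡⟨ e₁ (u ^ l) (v ^ m) A B (v ^ l) ⟩
  v ^ m * u ^ l * A + (u ^ l * B + v ^ l * B) ≤⟨ +-monoˡ-≤ _ (*-monoˡ-≤ A (^-exchange l≤m v≤u)) ⟩
  v ^ l * u ^ m * A + (u ^ l * B + v ^ l * B) ≡⟨ e₂ (u ^ l) (u ^ m) A B (v ^ l) ⟩
  v ^ l * (u ^ m * A + B) + u ^ l * B         ∎
  where
  open ≤-Reasoning
  A = layers ls R
  B = layers (m ∷ ls) R
  e₁ : ∀ p q A B r → p * (q * A + B) + r * B ≡ q * p * A + (p * B + r * B)
  e₁ = solve-∀
  e₂ : ∀ p q A B r → r * q * A + (p * B + r * B) ≡ r * (q * A + B) + p * B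
  e₂ = solve-∀

≼-swap : ∀ {u v} R → v ≤ u → (u ∷ v ∷ R) ≼ (v ∷ u ∷ R)
≼-swap {u} {v} R v≤u = dominated lay blo
  where
  open ≤-Reasoning
  lay : ∀ {ls} → Sorted ls → All (1 ≤_) ls → layers ls (u ∷ v ∷ R) ≤ layers ls (v ∷ u ∷ R)
  lay {[]} _ _ = ≤-refl
  lay {l ∷ ls} (l≤ ∷ _) _ = begin
    u ^ l * layers ls (v ∷ R) + (v ^ l * B + E) ≡⟨ +-assoc (u ^ l * layers ls (v ∷ R)) _ E ⟨
    u ^ l * layers ls (v ∷ R) + v ^ l * B + E   ≤⟨ +-monoˡ-≤ E (layers-swap-head l ls R v≤u l≤) ⟩
    v ^ l * layers ls (u ∷ R) + u ^ l * B + E   ≡⟨ +-assoc (v ^ l * layers ls (u ∷ R)) _ E ⟩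
    v ^ l * layers ls (u ∷ R) + (u ^ l * B + E) ∎
    where
    B = layers ls R
    E = layers (l ∷ ls) R
  blo : ∀ {ls} → Sorted ls → All (1 ≤_) ls → ∀ x a → blocks x a ls (u ∷ v ∷ R) ≤ blocks x a ls (v ∷ u ∷ R)
  blo {[]} _ _ x a = ≤-reflexive (e a u (pred a) v (blocks x (pred (pred a)) [] R) (blocks x (pred a) [] R) (blocks x a [] R))
    where
    e : ∀ a u a′ v p q r →
      a * (u * (a′ * (v * p) + q)) + (a * (v * q) + r) ≡ a * (v * (a′ * (u * p) + q)) + (a * (u * q) + r)
    e = solve-∀
  blo {l ∷ ls} (l≤ ∷ _) (1≤l ∷ _) x a = begin
    X * (u ^ l * layers ls (v ∷ R)) + (a * (u * (X′ * (v ^ l * B) + (a′ * (v * G₂) + G₁))) + (X * (v ^ l * B) + (a * (v * G₁) + G₀)))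
      ≡⟨ e₁ X (u ^ l * layers ls (v ∷ R)) a u X′ (v ^ l) B a′ v G₂ G₁ G₀ ⟩
    X * (u ^ l * layers ls (v ∷ R) + v ^ l * B) + (v ^ l * u * (a * X′ * B) + rest)
      ≤⟨ +-mono-≤ (*-monoʳ-≤ X (layers-swap-head l ls R v≤u l≤)) (+-monoˡ-≤ rest (*-monoˡ-≤ (a * X′ * B) exch)) ⟩
    X * (v ^ l * layers ls (u ∷ R) + u ^ l * B) + (u ^ l * v * (a * X′ * B) + rest)
      ≡⟨ e₂ X (v ^ l * layers ls (u ∷ R)) a u X′ (u ^ l) B a′ v G₂ G₁ G₀ ⟩
    X * (v ^ l * layers ls (u ∷ R)) + (a * (v * (X′ * (u ^ l * B) + (a′ * (u * G₂) + G₁))) + (X * (u ^ l * B) + (a * (u * G₁) + G₀)))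
      ∎
    where
    X = x ^ a
    X′ = x ^ pred a
    a′ = pred a
    B = layers ls R
    G₀ = blocks x a (l ∷ ls) R
    G₁ = blocks x (pred a) (l ∷ ls) R
    G₂ = blocks x (pred (pred a)) (l ∷ ls) R
    rest = a * (u * (a′ * (v * G₂))) + a * ((u + v) * G₁) + G₀
    -- A singleton is a layer of exponent 1, so `1 ≤ l` makes this another exchange.
    exch : v ^ l * u ≤ u ^ l * v
    exch = begin
      v ^ l * u     ≡⟨ cong (v ^ l *_) (*-identityʳ u) ⟨
      v ^ l * u ^ 1 ≤⟨ ^-exchange 1≤l v≤u ⟩
      v ^ 1 * u ^ l ≡⟨ cong (_* u ^ l) (*-identityʳ v) ⟩
      v * u ^ l     ≡⟨ *-comm v _ ⟩
      u ^ l * v     ∎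
    e₁ : ∀ X P a u X′ Q B a′ v G₂ G₁ G₀ →
      X * P + (a * (u * (X′ * (Q * B) + (a′ * (v * G₂) + G₁))) + (X * (Q * B) + (a * (v * G₁) + G₀))) ≡
      X * (P + Q * B) + (Q * u * (a * X′ * B) + (a * (u * (a′ * (v * G₂))) + a * ((u + v) * G₁) + G₀))
    e₁ = solve-∀
    e₂ : ∀ X P a u X′ Q B a′ v G₂ G₁ G₀ →
      X * (P + Q * B) + (Q * v * (a * X′ * B) + (a * (u * (a′ * (v * G₂))) + a * ((u + v) * G₁) + G₀)) ≡
      X * P + (a * (v * (X′ * (Q * B) + (a′ * (u * G₂) + G₁))) + (X * (Q * B) + (a * (u * G₁) + G₀)))
    e₂ = solve-∀

-- The field `keeps` carries the induction: it shows in `insert` that the head `w` stays below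
-- everything after it.
record Sorting (vs : List ℕ) : Set where
  field
    list   : List ℕ
    sorted : Sorted list
    above  : vs ≼ list
    same-sum    : sum list ≡ sum vs
    same-length : length list ≡ length vs
    keeps       : ∀ {t} → All (t ≤_) vs → All (t ≤_) list

insert : ∀ v vs → Sorted vs → Sorting (v ∷ vs)
insert v [] _ = record
  { list = v ∷ [] ; sorted = [] ∷ [] ; above = ≼-refl ; same-sum = refl ; same-length = refl ; keeps = λ p → p }
insert v (w ∷ vs) s@(w≤ ∷ s′) with ≤-total v w
... | inj₁ v≤w = record
  { list = v ∷ w ∷ vs ; sorted = (v≤w ∷ All.map (≤-trans v≤w) w≤) ∷ s ; above = ≼-refl
  ; same-sum = refl ; same-length = refl ; keeps = λ p → p }
... | inj₂ w≤v = record
  { list = w ∷ list ; sorted = keeps (w≤v ∷ w≤) ∷ sorted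
  ; above = ≼-trans (≼-swap vs w≤v) (≼-cons w above)
  ; same-sum = trans (cong (w +_) same-sum) (e w v (sum vs))
  ; same-length = cong suc same-length
  ; keeps = λ { (p ∷ q ∷ r) → q ∷ keeps (p ∷ r) } }
  where
  open Sorting (insert v vs s′)
  e : ∀ w v s → w + (v + s) ≡ v + (w + s)
  e = solve-∀

sort : ∀ vs → Sorting vs
sort [] = record
  { list = [] ; sorted = [] ; above = ≼-refl ; same-sum = refl ; same-length = refl ; keeps = λ p → p }
sort (v ∷ vs) = record
  { list = I.list ; sorted = I.sorted ; above = ≼-trans (≼-cons v R.above) I.above
  ; same-sum = trans I.same-sum (cong (v +_) R.same-sum)
  ; same-length = trans I.same-length (cong suc R.same-length)
  ; keeps = λ { (p ∷ q) → I.keeps (p ∷ R.keeps q) } }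
  where
  module R = Sorting (sort vs)
  module I = Sorting (insert v R.list R.sorted)

record Reduction (x a : ℕ) (ls vs : List ℕ) : Set where
  constructor reduction
  field
    mass    : ℕ
    list    : List ℕ
    shorter : suc (length list) ≡ length vs
    total   : mass + sum list ≡ x + sum vs
    above   : blocks x a ls vs ≤ blocks mass a ls list

splitAtEnd : ∀ k v w (vs : List ℕ) → k ≤ length vs →
  ∃ λ L → ∃ λ y → ∃ λ z → ∃ λ T → v ∷ w ∷ vs ≡ L ++ y ∷ z ∷ T × length T ≡ k
splitAtEnd k v w vs p with m≤n⇒m<n∨m≡n p
... | inj₂ eq = [] , v , w , vs , refl , sym eq
splitAtEnd k v w (u ∷ vs) _ | inj₁ (s≤s p) with splitAtEnd k w u vs p
... | L , y , z , T , eq , len = v ∷ L , y , z , T , cong (v ∷_) eq , len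

Sorted-++⁻ʳ : ∀ L {W} → Sorted (L ++ W) → Sorted W
Sorted-++⁻ʳ [] s = s
Sorted-++⁻ʳ (_ ∷ L) (_ ∷ s) = Sorted-++⁻ʳ L s

Top-tail : ∀ {x y} L {v V W k} → v ∷ V ≡ L ++ y ∷ W → Top x k W → Top x k V
Top-tail [] refl top = top
Top-tail (_ ∷ L) refl top = Top-++ L (skip top)

reduce : ∀ x a ls vs → All (a ≤_) ls → length ls ≤ excess a → Sorted vs →
  length ls < length vs → Reduction x a ls vs
reduce x a [] (v ∷ V) a≤ k≤c sV (s≤s k≤V) =
  reduction (x + v) V refl (+-assoc x v (sum V)) (absorb-head a [] V a≤ k≤c sV k≤V none)
reduce x a (l ∷ ls) vs@(v ∷ V@(w ∷ V′)) a≤@(a≤l ∷ _) k≤c sV (s≤s k≤V) with splitAtEnd (length ls) v w V′ (≤-pred k≤V)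
-- For a pattern with k layers `T` has k - 1 entries, so `z` is the k-th largest layer and its
-- comparison with `x` decides between absorbing and merging.
... | L , y , z , T , eq , len with ≤-total x z
...   | inj₁ x≤z = reduction (x + v) V refl (+-assoc x v (sum V))
        (absorb-head a (l ∷ ls) V a≤ k≤c sV k≤V
          (Top-tail L eq (top (Sorted-++⁻ʳ L (subst Sorted eq sV)))))
  where
  top : Sorted (y ∷ z ∷ T) → Top x (suc (length ls)) (z ∷ T)
  top (_ ∷ (z≤T ∷ _)) = Top-all (x≤z ∷ All.map (≤-trans x≤z) z≤T) (s≤s (≤-reflexive (sym len)))
...   | inj₂ z≤x = reduction x (L ++ (y + z) ∷ T) shorter total above
  where
  shorter : suc (length (L ++ (y + z) ∷ T)) ≡ length vs
  shorter = trans (cong suc (length-++ L))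
    (trans (sym (+-suc (length L) (suc (length T)))) (trans (sym (length-++ L)) (cong length (sym eq))))
  total : x + sum (L ++ (y + z) ∷ T) ≡ x + sum vs
  total = cong (x +_) (trans (sum-++ L ((y + z) ∷ T))
    (trans (cong (sum L +_) (+-assoc y z (sum T))) (trans (sym (sum-++ L (y ∷ z ∷ T))) (cong sum (sym eq)))))
  above : blocks x a (l ∷ ls) vs ≤ blocks x a (l ∷ ls) (L ++ (y + z) ∷ T)
  above = subst (λ ws → blocks x a (l ∷ ls) ws ≤ blocks x a (l ∷ ls) (L ++ (y + z) ∷ T)) (sym eq)
    (merge-blocks a L l ls T (Sorted-++⁻ʳ L (subst Sorted eq sV)) z≤x a≤l
      (All.map (λ a≤m → ≤-trans k≤c (excess-mono a≤m)) a≤) ≤-refl len)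

-- Weighted AM-GM over the natural numbers

2xy≤x²+y² : ∀ x y → 2 * (x * y) ≤ x * x + y * y
2xy≤x²+y² x y with ≤-total x y
... | inj₁ x≤y = go x≤y
  where
  go : ∀ {x y} → x ≤ y → 2 * (x * y) ≤ x * x + y * y
  go {x} x≤y with m≤n⇒∃[o]m+o≡n x≤y
  ... | d , refl = ≤-trans (m≤m+n _ (d * d)) (≤-reflexive (e x d))
    where
    e : ∀ x d → 2 * (x * (x + d)) + d * d ≡ x * x + (x + d) * (x + d)
    e = solve-∀
... | inj₂ y≤x with m≤n⇒∃[o]m+o≡n y≤x
...   | d , refl = ≤-trans (m≤m+n _ (d * d)) (≤-reflexive (e y d))
  where
  e : ∀ y d → 2 * ((y + d) * y) + d * d ≡ (y + d) * (y + d) + y * y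
  e = solve-∀

-- Convexity: the power `suc n` lies above its tangent at `B`, with the negative term moved to the
-- other side.
tangent : ∀ n A B → suc n * (A * B ^ n) ≤ A ^ suc n + n * B ^ suc n
tangent zero A B = ≤-reflexive (e A)
  where
  e : ∀ A → 1 * (A * 1) ≡ A * 1 + 0
  e = solve-∀
tangent (suc n) A B = +-cancelˡ-≤ (suc n * (A * A * P) + n * (A * (B * P))) _ _ (begin
  suc n * (A * A * P) + n * (A * (B * P)) + suc (suc n) * (A * (B * P))
    ≡⟨ e₁ n A B P ⟩
  A * (suc n * (A * P)) + suc n * P * (2 * (A * B))
    ≤⟨ +-mono-≤ (*-monoʳ-≤ A (tangent n A B)) (*-monoʳ-≤ (suc n * P) (2xy≤x²+y² A B)) ⟩
  A * (A ^ suc n + n * (B * P)) + suc n * P * (A * A + B * B)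
    ≡⟨ e₂ n A B P (A ^ suc n) ⟩
  suc n * (A * A * P) + n * (A * (B * P)) + (A * A ^ suc n + suc n * (B * (B * P))) ∎)
  where
  open ≤-Reasoning
  P = B ^ n
  e₁ : ∀ n A B P → suc n * (A * A * P) + n * (A * (B * P)) + suc (suc n) * (A * (B * P)) ≡
    A * (suc n * (A * P)) + suc n * P * (2 * (A * B))
  e₁ = solve-∀
  e₂ : ∀ n A B P Q → A * (Q + n * (B * P)) + suc n * P * (A * A + B * B) ≡
    suc n * (A * A * P) + n * (A * (B * P)) + (A * Q + suc n * (B * (B * P)))
  e₂ = solve-∀

^-distribʳ-* : ∀ x y n → (x * y) ^ n ≡ x ^ n * y ^ n
^-distribʳ-* x y zero = refl
^-distribʳ-* x y (suc n) = trans (cong (x * y *_) (^-distribʳ-* x y n)) (e x y (x ^ n) (y ^ n))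
  where
  e : ∀ x y X Y → x * y * (X * Y) ≡ x * X * (y * Y)
  e = solve-∀

n^n≢0 : ∀ n → NonZero (n ^ n)
n^n≢0 zero = _
n^n≢0 (suc n) = m^n≢0 (suc n) (suc n)

amgm-step : ∀ n s x → s ^ n * x * suc n ^ suc n ≤ n ^ n * (s + x) ^ suc n
amgm-step zero s x = begin
  1 * x * 1             ≡⟨ e x ⟩
  1 * (x * 1)           ≤⟨ *-monoʳ-≤ 1 (*-monoˡ-≤ 1 (m≤n+m x s)) ⟩
  1 * ((s + x) * 1)     ∎
  where
  open ≤-Reasoning
  e : ∀ x → 1 * x * 1 ≡ 1 * (x * 1)
  e = solve-∀
amgm-step n@(suc _) s x = *-cancelˡ-≤ n (+-cancelʳ-≤ (n * (B * B ^ n)) _ _ (begin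
  n * (s ^ n * x * (suc n * suc n ^ n)) + n * (B * B ^ n)
    ≡⟨ cong (λ P → n * (s ^ n * x * (suc n * suc n ^ n)) + n * (B * P)) (^-distribʳ-* (suc n) s n) ⟩
  n * (s ^ n * x * (suc n * suc n ^ n)) + n * (B * (suc n ^ n * s ^ n))
    ≡⟨ e n (s ^ n) x (suc n ^ n) s ⟩
  suc n * (A * (suc n ^ n * s ^ n))
    ≡⟨ cong (λ P → suc n * (A * P)) (^-distribʳ-* (suc n) s n) ⟨
  suc n * (A * B ^ n)
    ≤⟨ tangent n A B ⟩
  A ^ suc n + n * (B * B ^ n)
    ≡⟨ cong (_+ n * (B * B ^ n)) (trans (^-distribʳ-* n (s + x) (suc n)) (*-assoc n (n ^ n) _)) ⟩
  n * (n ^ n * (s + x) ^ suc n) + n * (B * B ^ n) ∎))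
  where
  open ≤-Reasoning
  -- `A` and `B` coincide exactly in the equality case `n * x = s`.
  A = n * (s + x)
  B = suc n * s
  e : ∀ n S x N s → n * (S * x * (suc n * N)) + n * (suc n * s * (N * S)) ≡ suc n * (n * (s + x) * (N * S))
  e = solve-∀

amgm : ∀ xs → product xs * length xs ^ length xs ≤ sum xs ^ length xs
amgm [] = ≤-refl
amgm (x ∷ xs) = *-cancelʳ-≤ _ _ (n ^ n) {{n^n≢0 n}} (begin
  x * P * N * n ^ n       ≡⟨ e₁ x P N (n ^ n) ⟩
  P * n ^ n * x * N       ≤⟨ *-monoˡ-≤ N (*-monoˡ-≤ x (amgm xs)) ⟩
  sum xs ^ n * x * N      ≤⟨ amgm-step n (sum xs) x ⟩
  n ^ n * (sum xs + x) ^ suc n ≡⟨ cong (λ s → n ^ n * s ^ suc n) (+-comm (sum xs) x) ⟩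
  n ^ n * (x + sum xs) ^ suc n ≡⟨ *-comm (n ^ n) _ ⟩
  (x + sum xs) ^ suc n * n ^ n ∎)
  where
  open ≤-Reasoning
  n = length xs
  P = product xs
  N = suc n ^ suc n
  e₁ : ∀ x P N M → x * P * N * M ≡ P * M * x * N
  e₁ = solve-∀

sum-replicate : ∀ n x → sum (replicate n x) ≡ n * x
sum-replicate zero x = refl
sum-replicate (suc n) x = cong (x +_) (sum-replicate n x)

product-replicate : ∀ n x → product (replicate n x) ≡ x ^ n
product-replicate zero x = refl
product-replicate (suc n) x = cong (x *_) (product-replicate n x)

weighted-amgm : ∀ p q x y → x ^ p * y ^ q * (p + q) ^ (p + q) ≤ p ^ p * q ^ q * (x + y) ^ (p + q)
weighted-amgm zero q x y = begin
  1 * y ^ q * q ^ q         ≡⟨ e (y ^ q) (q ^ q) ⟩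
  1 * q ^ q * y ^ q         ≤⟨ *-monoʳ-≤ (1 * q ^ q) (^-monoˡ-≤ q (m≤n+m y x)) ⟩
  1 * q ^ q * (x + y) ^ q   ∎
  where
  open ≤-Reasoning
  e : ∀ a b → 1 * a * b ≡ 1 * b * a
  e = solve-∀
weighted-amgm p@(suc _) zero x y = subst (λ n → x ^ p * 1 * n ^ n ≤ p ^ p * 1 * (x + y) ^ n) (sym (+-identityʳ p)) (begin
  x ^ p * 1 * p ^ p         ≡⟨ e (x ^ p) (p ^ p) ⟩
  p ^ p * 1 * x ^ p         ≤⟨ *-monoʳ-≤ (p ^ p * 1) (^-monoˡ-≤ p (m≤m+n x y)) ⟩
  p ^ p * 1 * (x + y) ^ p   ∎)
  where
  open ≤-Reasoning
  e : ∀ a b → a * 1 * b ≡ b * 1 * a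
  e = solve-∀
weighted-amgm p@(suc _) q@(suc _) x y =
  *-cancelˡ-≤ (q ^ p * p ^ q) {{m*n≢0 (q ^ p) (p ^ q) {{m^n≢0 q p}} {{m^n≢0 p q}}}} (begin
  q ^ p * p ^ q * (x ^ p * y ^ q * N)
    ≡⟨ e₁ (q ^ p) (p ^ q) (x ^ p) (y ^ q) N ⟩
  q ^ p * x ^ p * (p ^ q * y ^ q) * N
    ≡⟨ cong₂ (λ u v → u * v * N) (^-distribʳ-* q x p) (^-distribʳ-* p y q) ⟨
  (q * x) ^ p * (p * y) ^ q * N
    ≡⟨ cong₂ _*_ prod (cong₂ _^_ len len) ⟨
  product xs * length xs ^ length xs
    ≤⟨ amgm xs ⟩
  sum xs ^ length xs
    ≡⟨ cong₂ _^_ total len ⟩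
  (p * q * (x + y)) ^ (p + q)
    ≡⟨ ^-distribʳ-* (p * q) (x + y) (p + q) ⟩
  (p * q) ^ (p + q) * S
    ≡⟨ cong (_* S) (trans (^-distribʳ-* p q (p + q)) (cong₂ _*_ (^-distribˡ-+-* p p q) (^-distribˡ-+-* q p q))) ⟩
  p ^ p * p ^ q * (q ^ p * q ^ q) * S
    ≡⟨ e₂ (p ^ p) (p ^ q) (q ^ p) (q ^ q) S ⟩
  q ^ p * p ^ q * (p ^ p * q ^ q * S) ∎)
  where
  open ≤-Reasoning
  N = (p + q) ^ (p + q)
  S = (x + y) ^ (p + q)
  -- These are `p` copies of x / p and `q` copies of y / q, scaled by `p * q` to be integral.
  xs = replicate p (q * x) ++ replicate q (p * y)
  len : length xs ≡ p + q
  len = trans (length-++ (replicate p (q * x))) (cong₂ _+_ (length-replicate p) (length-replicate q))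
  prod : product xs ≡ (q * x) ^ p * (p * y) ^ q
  prod = trans (product-++ (replicate p (q * x)) (replicate q (p * y)))
    (cong₂ _*_ (product-replicate p (q * x)) (product-replicate q (p * y)))
  total : sum xs ≡ p * q * (x + y)
  total = trans (sum-++ (replicate p (q * x)) (replicate q (p * y)))
    (trans (cong₂ _+_ (sum-replicate p (q * x)) (sum-replicate q (p * y))) (e₀ p q x y))
    where
    e₀ : ∀ p q x y → p * (q * x) + q * (p * y) ≡ p * q * (x + y)
    e₀ = solve-∀
  e₁ : ∀ a b c d n → a * b * (c * d * n) ≡ a * c * (b * d) * n
  e₁ = solve-∀
  e₂ : ∀ a b c d n → a * b * (c * d) * n ≡ c * b * (a * d * n)
  e₂ = solve-∀

Πself : List ℕ → ℕ
Πself ls = product (map (λ l → l ^ l) ls)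

-- One induction step of the final estimate: mass `x` with exponent `p` joins a bound of degree `n`
-- in the mass `s`. The factor `n ^ n` cancels, also for `n = 0`.
combine-amgm : ∀ G p n s x P → G * n ^ n ≤ P * s ^ n →
  x ^ p * G * (p + n) ^ (p + n) ≤ p ^ p * P * (x + s) ^ (p + n)
combine-amgm G p n s x P h = *-cancelʳ-≤ _ _ (n ^ n) {{n^n≢0 n}} (begin
  x ^ p * G * N * n ^ n                    ≡⟨ e₁ (x ^ p) G N (n ^ n) ⟩
  G * n ^ n * (x ^ p * N)                  ≤⟨ *-monoˡ-≤ (x ^ p * N) h ⟩
  P * s ^ n * (x ^ p * N)                  ≡⟨ e₂ P (s ^ n) (x ^ p) N ⟩
  P * (x ^ p * s ^ n * N)                  ≤⟨ *-monoʳ-≤ P (weighted-amgm p n x s) ⟩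
  P * (p ^ p * n ^ n * (x + s) ^ (p + n))  ≡⟨ e₃ P (p ^ p) (n ^ n) ((x + s) ^ (p + n)) ⟩
  p ^ p * P * (x + s) ^ (p + n) * n ^ n    ∎)
  where
  open ≤-Reasoning
  N = (p + n) ^ (p + n)
  e₁ : ∀ X G N M → X * G * N * M ≡ G * M * (X * N)
  e₁ = solve-∀
  e₂ : ∀ P S X N → P * S * (X * N) ≡ P * (X * S * N)
  e₂ = solve-∀
  e₃ : ∀ P Q M S → P * (Q * M * S) ≡ Q * P * S * M
  e₃ = solve-∀

layers-bound : ∀ ls vs → length vs ≤ length ls → layers ls vs * sum ls ^ sum ls ≤ Πself ls * sum vs ^ sum ls
layers-bound [] vs _ = ≤-refl
layers-bound (l ∷ ls) [] _ = z≤n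
layers-bound (l ∷ ls) (v ∷ vs) (s≤s p)
  rewrite layers-short (l ∷ ls) vs (s≤s p) | +-identityʳ (v ^ l * layers ls vs) =
  combine-amgm (layers ls vs) l (sum ls) (sum vs) v (Πself ls) (layers-bound ls vs p)

blocks-exact : ∀ x a ls vs → length vs ≤ length ls → blocks x a ls vs ≤ x ^ a * layers ls vs
blocks-exact x a [] [] _ = ≤-reflexive (sym (*-identityʳ (x ^ a)))
blocks-exact x a (l ∷ ls) [] _ = z≤n
blocks-exact x a (l ∷ ls) (v ∷ vs) (s≤s p) =
  ≤-trans (≤-reflexive (blocks-single x a l ls v vs p)) (*-monoʳ-≤ (x ^ a) (m≤m+n _ _))

-- `m` bounds the number of host layers for termination; each round sorts, then removes one layer at
-- constant total mass.
blocks-bound : ∀ m x a ls vs → length vs ≤ m → Sorted ls → All (1 ≤_) ls → All (a ≤_) ls → length ls ≤ excess a →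
  blocks x a ls vs * (a + sum ls) ^ (a + sum ls) ≤ a ^ a * Πself ls * (x + sum vs) ^ (a + sum ls)
blocks-bound m x a ls vs len s o a≤ k≤c with length vs ≤? length ls
... | yes p = ≤-trans (*-monoˡ-≤ ((a + sum ls) ^ (a + sum ls)) (blocks-exact x a ls vs p))
                      (combine-amgm (layers ls vs) a (sum ls) (sum vs) x (Πself ls) (layers-bound ls vs p))
blocks-bound zero x a ls [] len s o a≤ k≤c | no ¬p with () ← ¬p z≤n
blocks-bound (suc m) x a ls vs len s o a≤ k≤c | no ¬p = begin
  blocks x a ls vs * N                        ≤⟨ *-monoˡ-≤ N (≤-trans (blocks-≤ S.above s o x a) R.above) ⟩
  blocks R.mass a ls R.list * N               ≤⟨ blocks-bound m R.mass a ls R.list len′ s o a≤ k≤c ⟩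
  a ^ a * Πself ls * (R.mass + sum R.list) ^ n ≡⟨ cong (λ t → a ^ a * Πself ls * t ^ n) (trans R.total (cong (x +_) S.same-sum)) ⟩
  a ^ a * Πself ls * (x + sum vs) ^ n         ∎
  where
  open ≤-Reasoning
  n = a + sum ls
  N = n ^ n
  module S = Sorting (sort vs)
  module R = Reduction (reduce x a ls S.list a≤ k≤c S.sorted
    (subst (length ls <_) (sym S.same-length) (≰⇒> ¬p)))
  len′ : length R.list ≤ m
  len′ = ≤-pred (≤-trans (≤-reflexive (trans R.shorter S.same-length)) len)

-- Symmetrisation: reducing an arbitrary host to a layered one

∑ : {B : Set} → List B → (B → ℕ) → ℕ
∑ [] g = 0
∑ (x ∷ xs) g = g x + ∑ xs g

∑-mono : {B : Set} {g h : B → ℕ} (xs : List B) → (∀ {x} → x ∈ xs → g x ≤ h x) → ∑ xs g ≤ ∑ xs h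
∑-mono [] _ = z≤n
∑-mono (x ∷ xs) p = +-mono-≤ (p (here refl)) (∑-mono xs (λ q → p (there q)))

∑-cong : {B : Set} {g h : B → ℕ} (xs : List B) → (∀ x → g x ≡ h x) → ∑ xs g ≡ ∑ xs h
∑-cong [] _ = refl
∑-cong (x ∷ xs) p = cong₂ _+_ (p x) (∑-cong xs p)

∑-zero : {B : Set} {g : B → ℕ} (xs : List B) → (∀ {x} → x ∈ xs → g x ≡ 0) → ∑ xs g ≡ 0
∑-zero [] _ = refl
∑-zero (x ∷ xs) p = cong₂ _+_ (p (here refl)) (∑-zero xs (λ q → p (there q)))

∑-+ : {B : Set} {g h : B → ℕ} (xs : List B) → ∑ xs (λ x → g x + h x) ≡ ∑ xs g + ∑ xs h
∑-+ [] = refl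
∑-+ {g = g} {h} (x ∷ xs) rewrite ∑-+ {g = g} {h} xs = e (g x) (h x) (∑ xs g) (∑ xs h)
  where
  e : ∀ a b c d → a + b + (c + d) ≡ a + c + (b + d)
  e = solve-∀

∑-* : {B : Set} {g : B → ℕ} (k : ℕ) (xs : List B) → ∑ xs (λ x → k * g x) ≡ k * ∑ xs g
∑-* k [] = sym (*-zeroʳ k)
∑-* {g = g} k (x ∷ xs) rewrite ∑-* {g = g} k xs = sym (*-distribˡ-+ k (g x) (∑ xs g))

∑-↭ : {B : Set} {g : B → ℕ} {xs ys : List B} → xs ↭ ys → ∑ xs g ≡ ∑ ys g
∑-↭ _↭_.refl = refl
∑-↭ {g = g} (prep x p) = cong (g x +_) (∑-↭ p)
∑-↭ {g = g} (swap x y p) = trans (cong (λ t → g x + (g y + t)) (∑-↭ p)) (e (g x) (g y) _)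
  where
  e : ∀ a b c → a + (b + c) ≡ b + (a + c)
  e = solve-∀
∑-↭ (_↭_.trans p q) = trans (∑-↭ p) (∑-↭ q)

labels : ℕ → List ℕ → List ℕ
labels b [] = []
labels b (r ∷ rs) = replicate r b ++ labels (suc b) rs

labels-≥ : ∀ b rs → All (b ≤_) (labels b rs)
labels-≥ b [] = []
labels-≥ b (r ∷ rs) = All-++⁺ (rep r) (All.map <⇒≤ (labels-≥ (suc b) rs))
  where
  rep : ∀ r → All (b ≤_) (replicate r b)
  rep zero = []
  rep (suc r) = ≤-refl ∷ rep r

Word : Set → Set
Word A = List (A × ℕ)

module _ {A : Set} where

  -- Sum of Φ over the subsequences of P of length |is|, labelled by is.
  choose : List A → List ℕ → (Word A → ℕ) → ℕ
  choose P [] Φ = Φ []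
  choose [] (i ∷ is) Φ = 0
  choose (p ∷ P) (i ∷ is) Φ = choose P is (λ f → Φ ((p , i) ∷ f)) + choose P (i ∷ is) Φ

  -- Weighted sum of Φ over all words, with repetitions, labelled by is.
  place : List (A × ℕ) → List ℕ → (Word A → ℕ) → ℕ
  place L [] Φ = Φ []
  place L (i ∷ is) Φ = ∑ L (λ (c , w) → w * place L is (λ f → Φ ((c , i) ∷ f)))

  choose-mono : ∀ P is {Φ Ψ} → (∀ f → Φ f ≤ Ψ f) → choose P is Φ ≤ choose P is Ψ
  choose-mono P [] p = p []
  choose-mono [] (i ∷ is) p = z≤n
  choose-mono (c ∷ P) (i ∷ is) p = +-mono-≤ (choose-mono P is (λ f → p ((c , i) ∷ f))) (choose-mono P (i ∷ is) p)

  choose-* : ∀ k P is {Φ} → choose P is (λ f → k * Φ f) ≡ k * choose P is Φ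
  choose-* k P [] = refl
  choose-* k [] (i ∷ is) = sym (*-zeroʳ k)
  choose-* k (c ∷ P) (i ∷ is) =
    trans (cong₂ _+_ (choose-* k P is) (choose-* k P (i ∷ is))) (sym (*-distribˡ-+ k _ _))

  choose-cons : ∀ p P is {Φ} → choose P is Φ ≤ choose (p ∷ P) is Φ
  choose-cons p P [] = ≤-refl
  choose-cons p P (i ∷ is) = m≤n+m _ _

  -- The right side forgets that the points labelled `js` come later in `P` than those labelled
  -- `is`, so that the layers can be treated separately.
  choose-++ : ∀ P is js {Φ} → choose P (is ++ js) Φ ≤ choose P is (λ f → choose P js (λ g → Φ (f ++ g)))
  choose-++ P [] js = ≤-refl
  choose-++ [] (i ∷ is) js = z≤n
  choose-++ (p ∷ P) (i ∷ is) js = +-mono-≤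
    (≤-trans (choose-++ P is js) (choose-mono P is (λ f → choose-cons p P js)))
    (≤-trans (choose-++ P (i ∷ is) js) (choose-mono P (i ∷ is) (λ f → choose-cons p P js)))

  place-mono : ∀ L is {Φ Ψ} → (∀ f → Φ f ≤ Ψ f) → place L is Φ ≤ place L is Ψ
  place-mono L [] p = p []
  place-mono L (i ∷ is) p = ∑-mono L (λ {(c , w)} _ → *-monoʳ-≤ w (place-mono L is (λ f → p ((c , i) ∷ f))))

  place-zero : ∀ L is {Φ} → (∀ f → Φ f ≡ 0) → place L is Φ ≡ 0
  place-zero L [] p = p []
  place-zero L (i ∷ is) p = ∑-zero L (λ {(c , w)} _ →
    trans (cong (w *_) (place-zero L is (λ f → p ((c , i) ∷ f)))) (*-zeroʳ w))

  place-++ : ∀ L is js {Φ} → place L (is ++ js) Φ ≡ place L is (λ f → place L js (λ g → Φ (f ++ g)))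
  place-++ L [] js = refl
  place-++ L (i ∷ is) js = ∑-cong L (λ (c , w) → cong (w *_) (place-++ L is js))

  place-↭ : ∀ {L L′} is {Φ} → L ↭ L′ → place L is Φ ≡ place L′ is Φ
  place-↭ [] p = refl
  place-↭ {L} (i ∷ is) p = trans (∑-cong L (λ (c , w) → cong (w *_) (place-↭ is p))) (∑-↭ p)

  Symmetric : (Word A → ℕ) → Set
  Symmetric Ψ = ∀ {f g} → f ↭ g → Ψ f ≤ Ψ g

  ones : List A → List (A × ℕ)
  ones = map (_, 1)

  -- Only the words in which p occurs at most once are counted on the left.
  place-once : ∀ p P r b {Ψ} → Symmetric Ψ →
    r * place (ones P) (replicate (pred r) b) (λ f → Ψ ((p , b) ∷ f)) + place (ones P) (replicate r b) Ψ ≤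
    place (ones (p ∷ P)) (replicate r b) Ψ
  place-once p P zero b symm = ≤-refl
  place-once p P (suc s) b {Ψ} symm = begin
    suc s * Q + ∑ W (λ (c , w) → w * place W ss (Ψ⟨ c ⟩))
      ≡⟨ +-assoc Q (s * Q) _ ⟩
    Q + (s * Q + ∑ W (λ (c , w) → w * place W ss (Ψ⟨ c ⟩)))
      ≤⟨ +-mono-≤ (≤-trans (m+n≤o⇒n≤o (s * place W (replicate (pred s) b) (λ f → Ψ ((p , b) ∷ (p , b) ∷ f))) (place-once p P s b (λ q → symm (prep _ q)))) (≤-reflexive (sym (*-identityˡ _))))
          (+-monoˡ-≤ _ (expand s)) ⟩
    1 * place (ones (p ∷ P)) ss (Ψ⟨ p ⟩) +
      (∑ W (λ (c , w) → w * (s * place W (replicate (pred s) b) (λ f → Ψ ((c , b) ∷ (p , b) ∷ f)))) +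
       ∑ W (λ (c , w) → w * place W ss (Ψ⟨ c ⟩)))
      ≡⟨ cong (1 * place (ones (p ∷ P)) ss (Ψ⟨ p ⟩) +_) (sym (∑-+ W)) ⟩
    1 * place (ones (p ∷ P)) ss (Ψ⟨ p ⟩) +
      ∑ W (λ (c , w) → w * (s * place W (replicate (pred s) b) (λ f → Ψ ((c , b) ∷ (p , b) ∷ f))) + w * place W ss (Ψ⟨ c ⟩))
      ≤⟨ +-monoʳ-≤ (1 * place (ones (p ∷ P)) ss (Ψ⟨ p ⟩))
          (∑-mono W (λ {(c , w)} _ → ≤-trans (≤-reflexive (sym (*-distribˡ-+ w _ _)))
            (*-monoʳ-≤ w (place-once p P s b (λ q → symm (prep _ q)))))) ⟩
    1 * place (ones (p ∷ P)) ss (Ψ⟨ p ⟩) + ∑ W (λ (c , w) → w * place (ones (p ∷ P)) ss (Ψ⟨ c ⟩)) ∎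
    where
    open ≤-Reasoning
    W = ones P
    ss = replicate s b
    Ψ⟨_⟩ : A → Word A → ℕ
    Ψ⟨ c ⟩ f = Ψ ((c , b) ∷ f)
    Q = place W ss (Ψ⟨ p ⟩)
    -- By symmetry `p` moves behind the first letter `c`, where the induction hypothesis for `c` can
    -- use it.
    expand : ∀ s → s * place W (replicate s b) (Ψ⟨ p ⟩) ≤
      ∑ W (λ (c , w) → w * (s * place W (replicate (pred s) b) (λ f → Ψ ((c , b) ∷ (p , b) ∷ f))))
    expand zero = z≤n
    expand (suc s) = ≤-trans (≤-reflexive (sym (∑-* (suc s) W)))
      (∑-mono W (λ {(c , w)} _ → ≤-trans (≤-reflexive (e (suc s) w _))
        (*-monoʳ-≤ w (*-monoʳ-≤ (suc s) (place-mono W (replicate s b) (λ f → symm (swap _ _ ↭-refl)))))))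
      where
      e : ∀ s w t → s * (w * t) ≡ w * (s * t)
      e = solve-∀

  choose≤place-layer : ∀ P r b {Ψ} → Symmetric Ψ →
    r ! * choose P (replicate r b) Ψ ≤ place (ones P) (replicate r b) Ψ
  choose≤place-layer P zero b symm = ≤-reflexive (*-identityˡ _)
  choose≤place-layer [] (suc r) b symm = ≤-reflexive (*-zeroʳ (suc r !))
  choose≤place-layer (p ∷ P) (suc r) b {Ψ} symm = begin
    suc r * r ! * (c₁ + c₂)             ≡⟨ e (suc r) (r !) c₁ c₂ ⟩
    suc r * (r ! * c₁) + suc r * r ! * c₂
      ≤⟨ +-mono-≤ (*-monoʳ-≤ (suc r) (choose≤place-layer P r b (λ q → symm (prep _ q)))) (choose≤place-layer P (suc r) b symm) ⟩
    suc r * place (ones P) (replicate r b) (λ f → Ψ ((p , b) ∷ f)) + place (ones P) (replicate (suc r) b) Ψ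
      ≤⟨ place-once p P (suc r) b symm ⟩
    place (ones (p ∷ P)) (replicate (suc r) b) Ψ ∎
    where
    open ≤-Reasoning
    c₁ = choose P (replicate r b) (λ f → Ψ ((p , b) ∷ f))
    c₂ = choose P (replicate (suc r) b) Ψ
    e : ∀ s t c d → s * t * (c + d) ≡ s * (t * c) + s * t * d
    e = solve-∀

  -- Reordering the points inside each layer turns one selection into `product (map _! rs)` words of
  -- equal value; words with repeated points only add.
  choose≤place : ∀ P b rs {Φ} → Symmetric Φ →
    product (map _! rs) * choose P (labels b rs) Φ ≤ place (ones P) (labels b rs) Φ
  choose≤place P b [] symm = ≤-reflexive (*-identityˡ _)
  choose≤place P b (r ∷ rs) {Φ} symm = begin
    r ! * F * choose P (replicate r b ++ ls) Φ
      ≤⟨ *-monoʳ-≤ (r ! * F) (choose-++ P (replicate r b) ls) ⟩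
    r ! * F * choose P (replicate r b) (λ f → choose P ls (λ g → Φ (f ++ g)))
      ≡⟨ *-assoc (r !) F _ ⟩
    r ! * (F * choose P (replicate r b) (λ f → choose P ls (λ g → Φ (f ++ g))))
      ≡⟨ cong (r ! *_) (sym (choose-* F P (replicate r b))) ⟩
    r ! * choose P (replicate r b) (λ f → F * choose P ls (λ g → Φ (f ++ g)))
      ≤⟨ *-monoʳ-≤ (r !) (choose-mono P (replicate r b) (λ f → choose≤place P (suc b) rs (λ q → symm (++⁺ˡ f q)))) ⟩
    r ! * choose P (replicate r b) (λ f → place (ones P) ls (λ g → Φ (f ++ g)))
      ≤⟨ choose≤place-layer P r b (λ q → place-mono (ones P) ls (λ g → symm (++⁺ʳ g q))) ⟩
    place (ones P) (replicate r b) (λ f → place (ones P) ls (λ g → Φ (f ++ g)))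
      ≡⟨ place-++ (ones P) (replicate r b) ls ⟨
    place (ones P) (replicate r b ++ ls) Φ ∎
    where
    open ≤-Reasoning
    F = product (map _! rs)
    ls = labels (suc b) rs

  Replaceable : A → A → (Word A → ℕ) → Set
  Replaceable x z Ψ = ∀ f i g → Ψ (f ++ (x , i) ∷ g) ≤ Ψ (f ++ (z , i) ∷ g)

  place-merge : ∀ {x y z p q} L is {Ψ} → Replaceable x z Ψ → Replaceable y z Ψ →
    place ((x , p) ∷ (y , q) ∷ L) is Ψ ≤ place ((z , p + q) ∷ L) is Ψ
  place-merge L [] rx ry = ≤-refl
  place-merge {x} {y} {z} {p} {q} L (i ∷ is) {Ψ} rx ry = begin
    p * place L₂ is (λ f → Ψ ((x , i) ∷ f)) + (q * place L₂ is (λ f → Ψ ((y , i) ∷ f)) + ∑ L (λ (c , w) → w * place L₂ is (λ f → Ψ ((c , i) ∷ f))))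
      ≤⟨ +-mono-≤ (*-monoʳ-≤ p (≤-trans (step x) (place-mono L₁ is (λ f → rx [] i f))))
          (+-mono-≤ (*-monoʳ-≤ q (≤-trans (step y) (place-mono L₁ is (λ f → ry [] i f))))
                    (∑-mono L (λ {(c , w)} _ → *-monoʳ-≤ w (step c)))) ⟩
    p * Z + (q * Z + ∑ L (λ (c , w) → w * place L₁ is (λ f → Ψ ((c , i) ∷ f))))
      ≡⟨ e p q Z _ ⟩
    (p + q) * Z + ∑ L (λ (c , w) → w * place L₁ is (λ f → Ψ ((c , i) ∷ f))) ∎
    where
    open ≤-Reasoning
    L₂ = (x , p) ∷ (y , q) ∷ L
    L₁ = (z , p + q) ∷ L
    Z = place L₁ is (λ f → Ψ ((z , i) ∷ f))
    step : ∀ c → place L₂ is (λ f → Ψ ((c , i) ∷ f)) ≤ place L₁ is (λ f → Ψ ((c , i) ∷ f))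
    step c = place-merge L is (λ f → rx ((c , i) ∷ f)) (λ f → ry ((c , i) ∷ f))
    e : ∀ p q Z S → p * Z + (q * Z + S) ≡ (p + q) * Z + S
    e = solve-∀

  -- Only occurrences of `y` after one of `x` are replaced, which is enough because `zykov` splits
  -- by which of the two comes first.
  Absorbs : A → A → (Word A → ℕ) → Set
  Absorbs x y Ψ = ∀ f i → Replaceable y x (λ g → Ψ (f ++ (x , i) ∷ g))

  -- A word is bounded by the one in which x and y are both replaced by whichever occurs first; that
  -- first occurrence is x with probability p / (p + q).
  zykov : ∀ {x y} p q L is {Ψ} → Absorbs x y Ψ → Absorbs y x Ψ →
    (p + q) * place ((x , p) ∷ (y , q) ∷ L) is Ψ ≤
    p * place ((x , p + q) ∷ L) is Ψ + q * place ((y , p + q) ∷ L) is Ψ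
  zykov p q L [] {Ψ} _ _ = ≤-reflexive (*-distribʳ-+ (Ψ []) p q)
  zykov {x} {y} p q L (i ∷ is) {Ψ} ax ay = begin
    (p + q) * (p * T L₂ x + (q * T L₂ y + ∑ L (λ (c , w) → w * T L₂ c)))
      ≤⟨ *-monoʳ-≤ (p + q) (+-mono-≤
           (*-monoʳ-≤ p (place-merge L is (λ _ _ _ → ≤-refl) (ax [] i)))
           (+-monoˡ-≤ _ (*-monoʳ-≤ q (place-merge L is (ay [] i) (λ _ _ _ → ≤-refl))))) ⟩
    (p + q) * (p * T Lx x + (q * T Ly y + ∑ L (λ (c , w) → w * T L₂ c)))
      ≡⟨ e₁ p q (T Lx x) (T Ly y) _ ⟩
    (p + q) * (p * T Lx x + q * T Ly y) + (p + q) * ∑ L (λ (c , w) → w * T L₂ c)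
      ≤⟨ +-monoʳ-≤ ((p + q) * (p * T Lx x + q * T Ly y)) rest ⟩
    (p + q) * (p * T Lx x + q * T Ly y) + (p * ∑ L (λ (c , w) → w * T Lx c) + q * ∑ L (λ (c , w) → w * T Ly c))
      ≡⟨ e₂ p q (T Lx x) (T Ly y) _ _ ⟩
    p * ((p + q) * T Lx x + ∑ L (λ (c , w) → w * T Lx c)) + q * ((p + q) * T Ly y + ∑ L (λ (c , w) → w * T Ly c)) ∎
    where
    open ≤-Reasoning
    L₂ = (x , p) ∷ (y , q) ∷ L
    Lx = (x , p + q) ∷ L
    Ly = (y , p + q) ∷ L
    T : List (A × ℕ) → A → ℕ
    T M c = place M is (λ f → Ψ ((c , i) ∷ f))
    e₀ : ∀ k w t → k * (w * t) ≡ w * (k * t)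
    e₀ = solve-∀
    e₃ : ∀ p q w s t → w * (p * s + q * t) ≡ p * (w * s) + q * (w * t)
    e₃ = solve-∀
    rest : (p + q) * ∑ L (λ (c , w) → w * T L₂ c) ≤ p * ∑ L (λ (c , w) → w * T Lx c) + q * ∑ L (λ (c , w) → w * T Ly c)
    rest = begin
      (p + q) * ∑ L (λ (c , w) → w * T L₂ c)
        ≡⟨ ∑-* (p + q) L ⟨
      ∑ L (λ (c , w) → (p + q) * (w * T L₂ c))
        ≤⟨ ∑-mono L (λ {(c , w)} _ → ≤-trans (≤-reflexive (e₀ (p + q) w (T L₂ c)))
             (≤-trans (*-monoʳ-≤ w (zykov p q L is (λ f → ax ((c , i) ∷ f)) (λ f → ay ((c , i) ∷ f))))
               (≤-reflexive (e₃ p q w (T Lx c) (T Ly c))))) ⟩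
      ∑ L (λ (c , w) → p * (w * T Lx c) + q * (w * T Ly c))
        ≡⟨ ∑-+ L ⟩
      ∑ L (λ (c , w) → p * (w * T Lx c)) + ∑ L (λ (c , w) → q * (w * T Ly c))
        ≡⟨ cong₂ _+_ (∑-* p L) (∑-* q L) ⟩
      p * ∑ L (λ (c , w) → w * T Lx c) + q * ∑ L (λ (c , w) → w * T Ly c) ∎
    e₁ : ∀ p q s t r → (p + q) * (p * s + (q * t + r)) ≡ (p + q) * (p * s + q * t) + (p + q) * r
    e₁ = solve-∀
    e₂ : ∀ p q s t r r′ → (p + q) * (p * s + q * t) + (p * r + q * r′) ≡ p * ((p + q) * s + r) + q * ((p + q) * t + r′)
    e₂ = solve-∀

  place-avoid : ∀ {z w} L is {Ψ} → (∀ f {i} g → i ∈ is → Ψ (f ++ (z , i) ∷ g) ≡ 0) →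
    place ((z , w) ∷ L) is Ψ ≤ place L is Ψ
  place-avoid L [] p = ≤-refl
  place-avoid {z} {w} L (i ∷ is) p = +-mono-≤
    (≤-reflexive (trans (cong (w *_) (place-zero ((z , w) ∷ L) is (λ f → p [] f (here refl)))) (*-zeroʳ w)))
    (∑-mono L (λ {(c , v)} _ → *-monoʳ-≤ v (place-avoid L is (λ f g q → p ((c , i) ∷ f) g (there q)))))

  place-force : ∀ {z w b} L is {Ψ} → (∀ {c v} → (c , v) ∈ L → ∀ f → Ψ ((c , b) ∷ f) ≡ 0) →
    place ((z , w) ∷ L) (b ∷ is) Ψ ≤ w * place ((z , w) ∷ L) is (λ f → Ψ ((z , b) ∷ f))
  place-force {z} {w} L is p = ≤-reflexive (trans
    (cong (w * place ((z , w) ∷ L) is _ +_)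
      (∑-zero L (λ {(c , v)} q → trans (cong (v *_) (place-zero ((z , w) ∷ L) is (p q))) (*-zeroʳ v))))
    (+-identityʳ _))

<⇒<ᵇ≡true : ∀ {i j} → i < j → (i <ᵇ j) ≡ true
<⇒<ᵇ≡true {zero} (s≤s _) = refl
<⇒<ᵇ≡true {suc i} (s≤s p) = <⇒<ᵇ≡true p

≥⇒<ᵇ≡false : ∀ {i j} → j ≤ i → (i <ᵇ j) ≡ false
≥⇒<ᵇ≡false z≤n = refl
≥⇒<ᵇ≡false (s≤s p) = ≥⇒<ᵇ≡false p

<ᵇ≡true⇒< : ∀ {i j} → (i <ᵇ j) ≡ true → i < j
<ᵇ≡true⇒< {zero} {suc j} _ = s≤s z≤n
<ᵇ≡true⇒< {suc i} {suc j} eq = s≤s (<ᵇ≡true⇒< eq)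

<ᵇ≡false⇒≥ : ∀ {i j} → (i <ᵇ j) ≡ false → j ≤ i
<ᵇ≡false⇒≥ {i} {zero} _ = z≤n
<ᵇ≡false⇒≥ {suc i} {suc j} eq = s≤s (<ᵇ≡false⇒≥ eq)

average-≤ : ∀ p q {t u v} → 0 < p → (p + q) * t ≤ p * u + q * v → t ≤ u ⊎ t ≤ v
average-≤ p q {t} {u} {v} 0<p h with t ≤? u | t ≤? v
... | yes t≤u | _ = inj₁ t≤u
... | no _ | yes t≤v = inj₂ t≤v
... | no t≰u | no t≰v = ⊥-elim (<-irrefl refl (begin-strict
    (p + q) * t          ≤⟨ h ⟩
    p * u + q * v        <⟨ +-monoˡ-< (q * v) (*-monoʳ-< p {{>-nonZero 0<p}} (≰⇒> t≰u)) ⟩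
    p * t + q * v        ≤⟨ +-monoʳ-≤ (p * t) (*-monoʳ-≤ q (<⇒≤ (≰⇒> t≰v))) ⟩
    p * t + q * t        ≡⟨ *-distribʳ-+ t p q ⟨
    (p + q) * t          ∎))
  where open ≤-Reasoning

-- Valid words and the passage to a chain

module _ {A : Set} (_≺_ : A → A → Bool) where

  Compatible : A × ℕ → A × ℕ → Set
  Compatible (c , i) (d , j) = (c ≺ d) ≡ (i <ᵇ j)

  -- Validity depends only on the set of entries. For irreflexive `_≺_` a point may therefore recur,
  -- but only under one label.
  Valid : Word A → Set
  Valid f = All (λ p → All (Compatible p) f) f

  abstract
    valid? : ∀ f → Dec (Valid f)
    valid? f = All.all? (λ (c , i) → All.all? (λ (d , j) → (c ≺ d) ≟ᵇ (i <ᵇ j)) f) f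

    indicator : Word A → ℕ
    indicator f = if does (valid? f) then 1 else 0

    indicator-≤1 : ∀ f → indicator f ≤ 1
    indicator-≤1 f with valid? f
    ... | yes _ = ≤-refl
    ... | no _ = z≤n

    indicator-yes : ∀ {f} → Valid f → indicator f ≡ 1
    indicator-yes {f} v with valid? f
    ... | yes _ = refl
    ... | no ¬v = ⊥-elim (¬v v)

    indicator-no : ∀ {f} → ¬ Valid f → indicator f ≡ 0
    indicator-no {f} ¬v with valid? f
    ... | yes v = ⊥-elim (¬v v)
    ... | no _ = refl

  indicator-mono : ∀ {f g} → (Valid f → Valid g) → indicator f ≤ indicator g
  indicator-mono {f} p with valid? f
  ... | yes v = ≤-trans (indicator-≤1 f) (≤-reflexive (sym (indicator-yes (p v))))
  ... | no ¬v = ≤-trans (≤-reflexive (indicator-no ¬v)) z≤n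

  compatible : ∀ {f p q} → Valid f → p ∈ f → q ∈ f → Compatible p q
  compatible v p∈f q∈f = All.lookup (All.lookup v p∈f) q∈f

  Valid-⊆ : ∀ {f g} → (∀ {p} → p ∈ g → p ∈ f) → Valid f → Valid g
  Valid-⊆ sub v = All.tabulate (λ p∈g → All.tabulate (λ q∈g → compatible v (sub p∈g) (sub q∈g)))

  indicator-⊆ : ∀ {f g} → (∀ {p} → p ∈ g → p ∈ f) → indicator f ≤ indicator g
  indicator-⊆ sub = indicator-mono (Valid-⊆ sub)

  indicator-sym : Symmetric indicator
  indicator-sym f↭g = indicator-⊆ (∈-resp-↭ (↭-sym f↭g))

  -- Compatibility in both directions forces incomparable `x` and `y` to carry the same label, so
  -- the new word has no entry that the old one lacks.
  absorbs : ∀ {x y} → (x ≺ y) ≡ false → (y ≺ x) ≡ false → Absorbs x y indicator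
  absorbs {x} {y} x⊀y y⊀x f i g j h = indicator-mono λ v →
    Valid-⊆ (sub (same-label (compatible v x∈ y∈) (compatible v y∈ x∈))) v
    where
    old = f ++ (x , i) ∷ (g ++ (y , j) ∷ h)
    x∈ : (x , i) ∈ old
    x∈ = ∈-++⁺ʳ f (here refl)
    y∈ : (y , j) ∈ old
    y∈ = ∈-++⁺ʳ f (there (∈-++⁺ʳ g (here refl)))
    same-label : (x ≺ y) ≡ (i <ᵇ j) → (y ≺ x) ≡ (j <ᵇ i) → i ≡ j
    same-label p q = ≤-antisym (<ᵇ≡false⇒≥ (trans (sym q) y⊀x)) (<ᵇ≡false⇒≥ (trans (sym p) x⊀y))
    sub : i ≡ j → ∀ {p} → p ∈ f ++ (x , i) ∷ (g ++ (x , j) ∷ h) → p ∈ old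
    sub eq p∈ with ∈-++⁻ f p∈
    ... | inj₁ p∈f = ∈-++⁺ˡ p∈f
    ... | inj₂ (here refl) = x∈
    ... | inj₂ (there p∈r) with ∈-++⁻ g p∈r
    ...   | inj₁ p∈g = ∈-++⁺ʳ f (there (∈-++⁺ˡ p∈g))
    ...   | inj₂ (here refl) = subst (λ t → (x , t) ∈ old) eq x∈
    ...   | inj₂ (there p∈h) = ∈-++⁺ʳ f (there (∈-++⁺ʳ g (there p∈h)))

  Before : A × ℕ → A × ℕ → Set
  Before p q = (proj₁ p ≺ proj₁ q) ≡ true

  Chain : List (A × ℕ) → Set
  Chain = AllPairs Before

  module _ (irrefl : ∀ x → (x ≺ x) ≡ false)
           (transitive : ∀ {x y z} → (x ≺ y) ≡ true → (y ≺ z) ≡ true → (x ≺ z) ≡ true) where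

    -- Once the chain's first point `z` carries the label `b`, every other letter `b` must be `z`
    -- again, and no larger label can be `z`.
    place-block : ∀ {z w} b r rs Γ → All (Before (z , w)) Γ →
      place ((z , w) ∷ Γ) (replicate r b ++ labels (suc b) rs) (λ f → indicator ((z , b) ∷ f)) ≤
      w ^ r * place Γ (labels (suc b) rs) indicator
    place-block {z} {w} b zero rs Γ z≺ = begin
      place ((z , w) ∷ Γ) ls (λ f → indicator ((z , b) ∷ f))
        ≤⟨ place-avoid Γ ls (λ f {i} g i∈ → indicator-no (λ v → repeated i (All.lookup (labels-≥ (suc b) rs) i∈)
             (compatible v (here refl) (there (∈-++⁺ʳ f (here refl)))))) ⟩
      place Γ ls (λ f → indicator ((z , b) ∷ f))
        ≤⟨ place-mono Γ ls (λ f → indicator-⊆ there) ⟩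
      place Γ ls indicator
        ≡⟨ *-identityˡ _ ⟨
      1 * place Γ ls indicator ∎
      where
      open ≤-Reasoning
      ls = labels (suc b) rs
      repeated : ∀ i → b < i → (z ≺ z) ≡ (b <ᵇ i) → ⊥
      repeated i b<i eq with () ← trans (sym (irrefl z)) (trans eq (<⇒<ᵇ≡true b<i))
    place-block {z} {w} b (suc r) rs Γ z≺ = begin
      place ((z , w) ∷ Γ) (b ∷ is) (λ f → indicator ((z , b) ∷ f))
        ≤⟨ place-force Γ is {Ψ = λ f → indicator ((z , b) ∷ f)} (λ c∈Γ f → indicator-no (λ v →
             later (All.lookup z≺ c∈Γ) (compatible v (here refl) (there (here refl))))) ⟩
      w * place ((z , w) ∷ Γ) is (λ f → indicator ((z , b) ∷ (z , b) ∷ f))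
        ≤⟨ *-monoʳ-≤ w (place-mono ((z , w) ∷ Γ) is (λ f → indicator-⊆ there)) ⟩
      w * place ((z , w) ∷ Γ) is (λ f → indicator ((z , b) ∷ f))
        ≤⟨ *-monoʳ-≤ w (place-block b r rs Γ z≺) ⟩
      w * (w ^ r * place Γ (labels (suc b) rs) indicator)
        ≡⟨ *-assoc w (w ^ r) _ ⟨
      w * w ^ r * place Γ (labels (suc b) rs) indicator ∎
      where
      open ≤-Reasoning
      is = replicate r b ++ labels (suc b) rs
      later : ∀ {c} → (z ≺ c) ≡ true → (z ≺ c) ≡ (b <ᵇ b) → ⊥
      later p eq with () ← trans (sym p) (trans eq (≥⇒<ᵇ≡false {b} ≤-refl))

    place-chain : ∀ b rs Γ → Chain Γ → All (1 ≤_) rs →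
      place Γ (labels b rs) indicator ≤ layers rs (map proj₂ Γ)
    place-chain b [] Γ _ _ = indicator-≤1 []
    place-chain b (zero ∷ rs) Γ _ (() ∷ _)
    place-chain b (suc r ∷ rs) [] _ _ = z≤n
    place-chain b (suc r ∷ rs) ((z , w) ∷ Γ) (z≺ ∷ chain) pos@(_ ∷ pos′) = +-mono-≤
      (begin
        w * place ((z , w) ∷ Γ) is (λ f → indicator ((z , b) ∷ f)) ≤⟨ *-monoʳ-≤ w (place-block b r rs Γ z≺) ⟩
        w * (w ^ r * place Γ (labels (suc b) rs) indicator)        ≡⟨ *-assoc w (w ^ r) _ ⟨
        w * w ^ r * place Γ (labels (suc b) rs) indicator          ≤⟨ *-monoʳ-≤ (w * w ^ r) (place-chain (suc b) rs Γ chain pos′) ⟩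
        w * w ^ r * layers rs (map proj₂ Γ)                        ∎)
      (≤-trans
        -- If a later point `c` takes the first label `b`, then `z` would need a label below `b`,
        -- and none is left.
        (∑-mono Γ (λ {(c , v)} c∈Γ → *-monoʳ-≤ v (place-avoid Γ is (λ f {i} g i∈ → indicator-no (λ v →
          earlier (All.lookup z≺ c∈Γ) (≥b i∈) (compatible v (there (∈-++⁺ʳ f (here refl))) (here refl)))))))
        (place-chain b (suc r ∷ rs) Γ chain pos))
      where
      open ≤-Reasoning
      is = replicate r b ++ labels (suc b) rs
      ≥b : ∀ {i} → i ∈ is → b ≤ i
      ≥b i∈ = All.lookup (labels-≥ b (r ∷ rs)) i∈
      earlier : ∀ {c i} → (z ≺ c) ≡ true → b ≤ i → (z ≺ c) ≡ (i <ᵇ b) → ⊥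
      earlier p b≤i eq with () ← trans (sym p) (trans eq (≥⇒<ᵇ≡false b≤i))

    data Structure (L : List (A × ℕ)) : Set where
      chain : ∀ {Γ} → L ↭ Γ → Chain Γ → Structure L
      twins : ∀ {x y p q L′} → L ↭ (x , p) ∷ (y , q) ∷ L′ → (x ≺ y) ≡ false → (y ≺ x) ≡ false → Structure L

    insert-chain : ∀ c Γ → Chain Γ → Structure (c ∷ Γ)
    insert-chain c [] _ = chain ↭-refl ([] ∷ [])
    insert-chain c@(x , p) (d@(y , q) ∷ Γ) ch@(d≺ ∷ ch′) with x ≺ y in x≺y | y ≺ x in y≺x
    ... | true | _ = chain ↭-refl ((x≺y ∷ All.map (transitive x≺y) d≺) ∷ ch)
    ... | false | false = twins ↭-refl x≺y y≺x
    ... | false | true with insert-chain c Γ ch′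
    ...   | chain c∷Γ↭ s = chain (↭-trans (swap c d ↭-refl) (prep d c∷Γ↭)) (All-resp-↭ c∷Γ↭ (y≺x ∷ d≺) ∷ s)
    ...   | twins {L′ = L′} c∷Γ↭ n₁ n₂ =
            twins (↭-trans (swap c d ↭-refl) (↭-trans (prep d c∷Γ↭) (↭-trans (swap _ _ ↭-refl) (prep _ (swap _ _ ↭-refl))))) n₁ n₂

    structure : ∀ L → Structure L
    structure [] = chain ↭-refl []
    structure (c ∷ L) with structure L
    ... | twins L↭ n₁ n₂ = twins (↭-trans (prep c L↭) (↭-trans (swap _ _ ↭-refl) (prep _ (swap _ _ ↭-refl)))) n₁ n₂
    ... | chain {Γ} L↭ ch with insert-chain c Γ ch
    ...   | chain Γ↭ ch′ = chain (↭-trans (prep c L↭) Γ↭) ch′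
    ...   | twins Γ↭ n₁ n₂ = twins (↭-trans (prep c L↭) Γ↭) n₁ n₂

    -- `m` bounds the number of points, which drops by one at each move. Positive weights let
    -- `average-≤` select a move that loses nothing.
    place≤layers : ∀ m b rs L → length L ≤ m → All (λ p → 0 < proj₂ p) L → All (1 ≤_) rs →
      ∃ λ ws → sum ws ≡ sum (map proj₂ L) × place L (labels b rs) indicator ≤ layers rs ws
    place≤layers m b rs L len pos pos′ with structure L
    ... | chain {Γ} L↭ ch = map proj₂ Γ , sym (sum-↭ (map⁺ proj₂ L↭)) ,
          ≤-trans (≤-reflexive (place-↭ (labels b rs) L↭)) (place-chain b rs Γ ch pos′)
    place≤layers zero b rs [] len pos pos′ | twins L↭ _ _ with () ← ↭-length L↭
    place≤layers (suc m) b rs L len pos pos′ | twins {x} {y} {p} {q} {L′} L↭ n₁ n₂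
      with 0<p ∷ 0<q ∷ posL′ ← All-resp-↭ L↭ pos =
      [ step x , step y ]′ (average-≤ p q 0<p (zykov p q L′ (labels b rs) (absorbs n₁ n₂) (absorbs n₂ n₁)))
      where
      step : ∀ z →
        place ((x , p) ∷ (y , q) ∷ L′) (labels b rs) indicator ≤ place ((z , p + q) ∷ L′) (labels b rs) indicator →
        ∃ λ ws → sum ws ≡ sum (map proj₂ L) × place L (labels b rs) indicator ≤ layers rs ws
      step z t≤
        with ws , total , below ← place≤layers m b rs ((z , p + q) ∷ L′)
               (≤-pred (≤-trans (≤-reflexive (sym (↭-length L↭))) len)) (≤-trans 0<p (m≤m+n p q) ∷ posL′) pos′ =
        ws , trans total (trans (+-assoc p q _) (sym (sum-↭ (map⁺ proj₂ L↭)))) ,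
        ≤-trans (≤-reflexive (place-↭ (labels b rs) L↭)) (≤-trans t≤ below)

-- Occurrences of a layered pattern as compatible words

-- The chain starts with an antilayer of mass 0, which only the reduction fills: every singleton is
-- played by its own layer, and `0 ^ 0 = 1` accounts for the empty antilayer.
layers≤blocks : ∀ a ls ws → a ! * layers (replicate a 1 ++ ls) ws ≤ blocks 0 a ls ws
layers≤blocks zero [] [] = ≤-refl
layers≤blocks zero [] (v ∷ ws) = layers≤blocks zero [] ws
layers≤blocks zero (l ∷ ls) [] = z≤n
layers≤blocks zero (l ∷ ls) (v ∷ ws) = begin
  1 * (v ^ l * layers ls ws + layers (l ∷ ls) ws)     ≡⟨ *-distribˡ-+ 1 (v ^ l * layers ls ws) (layers (l ∷ ls) ws) ⟩
  1 * (v ^ l * layers ls ws) + 1 * layers (l ∷ ls) ws ≤⟨ +-monoʳ-≤ (1 * (v ^ l * layers ls ws)) (layers≤blocks zero (l ∷ ls) ws) ⟩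
  1 * (v ^ l * layers ls ws) + blocks 0 0 (l ∷ ls) ws ∎
  where open ≤-Reasoning
layers≤blocks (suc a) ls [] = ≤-trans (≤-reflexive (*-zeroʳ (suc a !))) z≤n
layers≤blocks (suc a) ls (v ∷ ws) = begin
  suc a * a ! * (v ^ 1 * E + E′)                      ≡⟨ e (suc a) (a !) v E E′ ⟩
  suc a * (v * (a ! * E)) + suc a * a ! * E′
    ≤⟨ +-mono-≤ (*-monoʳ-≤ (suc a) (*-monoʳ-≤ v (layers≤blocks a ls ws))) (layers≤blocks (suc a) ls ws) ⟩
  suc a * (v * blocks 0 a ls ws) + blocks 0 (suc a) ls ws ≤⟨ tail ls ⟩
  blocks 0 (suc a) ls (v ∷ ws)                        ∎
  where
  open ≤-Reasoning
  E = layers (replicate a 1 ++ ls) ws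
  E′ = layers (replicate (suc a) 1 ++ ls) ws
  e : ∀ s t v x y → s * t * (v * 1 * x + y) ≡ s * (v * (t * x)) + s * t * y
  e = solve-∀
  tail : ∀ ls → suc a * (v * blocks 0 a ls ws) + blocks 0 (suc a) ls ws ≤ blocks 0 (suc a) ls (v ∷ ws)
  tail [] = ≤-refl
  tail (l ∷ ls) = ≤-refl

-- As in layeredFn, positions beyond the last layer count as singleton layers.
layerOf : List ℕ → ℕ → ℕ
layerOf [] p = p
layerOf (r ∷ rs) p = if p <ᵇ r then 0 else suc (layerOf rs (p ∸ r))

+-<ᵇ : ∀ r x y → (r + x <ᵇ r + y) ≡ (x <ᵇ y)
+-<ᵇ zero x y = refl
+-<ᵇ (suc r) x y = +-<ᵇ r x y

-- Points of a layered permutation are comparable exactly when they lie in different layers. This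
-- supplies the labels of the pattern and the order of the layered host.
layerOf-<ᵇ : ∀ rs p q → (layerOf rs p <ᵇ layerOf rs q) ≡ (p <ᵇ q) ∧ (layeredFn rs p <ᵇ layeredFn rs q)
layerOf-<ᵇ [] p q = sym (∧-idem (p <ᵇ q))
layerOf-<ᵇ (r ∷ rs) p q with p <ᵇ r in p<r | q <ᵇ r in q<r
... | true | true with p <ᵇ q in p<q
...   | false = refl
...   | true = sym (≥⇒<ᵇ≡false (∸-monoʳ-≤ r (s≤s (<⇒≤ (<ᵇ≡true⇒< {p} {q} p<q)))))
layerOf-<ᵇ (r ∷ rs) p q | true | false
  rewrite <⇒<ᵇ≡true (≤-trans (<ᵇ≡true⇒< {p} {r} p<r) (<ᵇ≡false⇒≥ {q} {r} q<r)) =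
  sym (<⇒<ᵇ≡true (≤-trans (∸-monoʳ-< {o = 0} (s≤s z≤n) (<ᵇ≡true⇒< {p} {r} p<r)) (m≤m+n r _)))
layerOf-<ᵇ (r ∷ rs) p q | false | true
  rewrite ≥⇒<ᵇ≡false {p} {q} (<⇒≤ (≤-trans (<ᵇ≡true⇒< {q} {r} q<r) (<ᵇ≡false⇒≥ {p} {r} p<r))) = refl
layerOf-<ᵇ (r ∷ rs) p q | false | false
  with p′ , refl ← m≤n⇒∃[o]m+o≡n (<ᵇ≡false⇒≥ {p} {r} p<r)
  with q′ , refl ← m≤n⇒∃[o]m+o≡n (<ᵇ≡false⇒≥ {q} {r} q<r)
  rewrite m+n∸m≡n r p′ | m+n∸m≡n r q′ | +-<ᵇ r p′ q′ | +-<ᵇ r (layeredFn rs p′) (layeredFn rs q′) =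
  layerOf-<ᵇ rs p′ q′

layeredFn-involutive : ∀ rs p → layeredFn rs (layeredFn rs p) ≡ p
layeredFn-involutive [] p = refl
layeredFn-involutive (r ∷ rs) p with p <ᵇ r in p<r
... | true with d , refl ← m≤n⇒∃[o]m+o≡n (<ᵇ≡true⇒< {p} {r} p<r)
  rewrite m+n∸m≡n p d | <⇒<ᵇ≡true (s≤s (m≤n+m d p)) = m+n∸n≡m p d
layeredFn-involutive (r ∷ rs) p | false
  with p′ , refl ← m≤n⇒∃[o]m+o≡n (<ᵇ≡false⇒≥ {p} {r} p<r)
  rewrite m+n∸m≡n r p′ | ≥⇒<ᵇ≡false (m≤m+n r (layeredFn rs p′)) | m+n∸m≡n r (layeredFn rs p′) =
  cong (r +_) (layeredFn-involutive rs p′)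

layeredFn-< : ∀ rs {N p} → sum rs ≤ N → p < N → layeredFn rs p < N
layeredFn-< [] _ p<N = p<N
layeredFn-< (r ∷ rs) {N} {p} s≤N p<N with p <ᵇ r in p<r
... | true = ≤-trans (∸-monoʳ-< {o = 0} (s≤s z≤n) (<ᵇ≡true⇒< {p} {r} p<r)) (m+n≤o⇒m≤o r s≤N)
... | false with N′ , refl ← m≤n⇒∃[o]m+o≡n (m+n≤o⇒m≤o r s≤N) =
  +-monoʳ-< r (layeredFn-< rs (+-cancelˡ-≤ r _ _ s≤N)
    (subst (p ∸ r <_) (m+n∸m≡n r N′) (∸-monoˡ-< p<N (<ᵇ≡false⇒≥ {p} {r} p<r))))

-- Reversing blocks is an involution. Positions beyond `sum rs` are fixed, so hosts of every length
-- `N` are available.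
layeredPerm : ∀ rs {N} → sum rs ≤ N → Permutation′ N
layeredPerm rs {N} s≤N = permutation f f inv inv
  where
  f : Fin N → Fin N
  f i = fromℕ< (layeredFn-< rs s≤N (toℕ<n i))
  inv : ∀ i → f (f i) ≡ i
  inv i = toℕ-injective (trans (toℕ-fromℕ< _)
    (trans (cong (layeredFn rs) (toℕ-fromℕ< _)) (layeredFn-involutive rs (toℕ i))))

applyUpTo-+ : ∀ {B : Set} (f : ℕ → B) m n → applyUpTo f (m + n) ≡ applyUpTo f m ++ applyUpTo (λ i → f (m + i)) n
applyUpTo-+ f zero n = refl
applyUpTo-+ f (suc m) n = cong (f 0 ∷_) (applyUpTo-+ (f ∘ suc) m n)

applyUpTo-cong : ∀ {B : Set} {f g : ℕ → B} n → (∀ i → i < n → f i ≡ g i) → applyUpTo f n ≡ applyUpTo g n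
applyUpTo-cong zero _ = refl
applyUpTo-cong (suc n) p = cong₂ _∷_ (p 0 (s≤s z≤n)) (applyUpTo-cong n (λ i i<n → p (suc i) (s≤s i<n)))

applyUpTo-const : ∀ {B : Set} (b : B) n → applyUpTo (λ _ → b) n ≡ replicate n b
applyUpTo-const b zero = refl
applyUpTo-const b (suc n) = cong (b ∷_) (applyUpTo-const b n)

labels-layerOf : ∀ b rs → applyUpTo (λ p → b + layerOf rs p) (sum rs) ≡ labels b rs
labels-layerOf b [] = refl
labels-layerOf b (r ∷ rs) = trans (applyUpTo-+ (λ p → b + layerOf (r ∷ rs) p) r (sum rs)) (cong₂ _++_
  (trans (applyUpTo-cong r first) (applyUpTo-const b r))
  (trans (applyUpTo-cong (sum rs) later) (labels-layerOf (suc b) rs)))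
  where
  first : ∀ i → i < r → b + layerOf (r ∷ rs) i ≡ b
  first i i<r rewrite <⇒<ᵇ≡true i<r = +-identityʳ b
  later : ∀ i → i < sum rs → b + layerOf (r ∷ rs) (r + i) ≡ suc b + layerOf rs i
  later i _ rewrite ≥⇒<ᵇ≡false (m≤m+n r i) | m+n∸m≡n r i = +-suc b (layerOf rs i)

tabulate-toℕ : ∀ {B : Set} (g : ℕ → B) n → tabulate {n = n} (λ i → g (toℕ i)) ≡ applyUpTo g n
tabulate-toℕ g zero = refl
tabulate-toℕ g (suc n) = cong (g 0 ∷_) (tabulate-toℕ (g ∘ suc) n)

toList-tabulate : ∀ {B : Set} (g : ℕ → B) n → toList (V.tabulate {n = n} (λ i → g (toℕ i))) ≡ applyUpTo g n
toList-tabulate g zero = refl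
toList-tabulate g (suc n) = cong (g 0 ∷_) (toList-tabulate (g ∘ suc) n)

vzip : ∀ {A : Set} {m} → Vec A m → Vec ℕ m → Word A
vzip [] [] = []
vzip (x ∷ xs) (i ∷ is) = (x , i) ∷ vzip xs is

All-vzip⁺ : ∀ {A : Set} {P : A × ℕ → Set} {m} (xs : Vec A m) is →
  (∀ j → P (lookup xs j , lookup is j)) → All P (vzip xs is)
All-vzip⁺ [] [] p = []
All-vzip⁺ (x ∷ xs) (i ∷ is) p = p zero ∷ All-vzip⁺ xs is (λ j → p (suc j))

All-vzip⁻ : ∀ {A : Set} {P : A × ℕ → Set} {m} (xs : Vec A m) is →
  All P (vzip xs is) → ∀ j → P (lookup xs j , lookup is j)
All-vzip⁻ (x ∷ xs) (i ∷ is) (p ∷ ps) zero = p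
All-vzip⁻ (x ∷ xs) (i ∷ is) (p ∷ ps) (suc j) = All-vzip⁻ xs is ps j

Increasing : ∀ {m n} → Vec (Fin n) m → Set
Increasing v = ∀ j k → (toℕ (lookup v j) <ᵇ toℕ (lookup v k)) ≡ (toℕ j <ᵇ toℕ k)

Increasing-map : ∀ {m n} (v : Vec (Fin n) m) → Increasing v → Increasing (V.map suc v)
Increasing-map v inc j k rewrite V.lookup-map j Fin.suc v | V.lookup-map k Fin.suc v = inc j k

Increasing-cons : ∀ {m n} (v : Vec (Fin n) m) → Increasing v → Increasing (zero ∷ V.map suc v)
Increasing-cons v inc zero zero = refl
Increasing-cons v inc zero (suc k) rewrite V.lookup-map k Fin.suc v = refl
Increasing-cons v inc (suc j) zero = refl
Increasing-cons v inc (suc j) (suc k) = Increasing-map v inc j k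

countB-++ : ∀ {B : Set} (f : B → Bool) xs ys → countB f (xs ++ ys) ≡ countB f xs + countB f ys
countB-++ f [] ys = refl
countB-++ f (x ∷ xs) ys with f x
... | true = cong suc (countB-++ f xs ys)
... | false = countB-++ f xs ys

countB-map : ∀ {B B′ : Set} (f : B′ → Bool) (g : B → B′) xs → countB f (map g xs) ≡ countB (f ∘ g) xs
countB-map f g [] = refl
countB-map f g (x ∷ xs) with f (g x)
... | true = cong suc (countB-map f g xs)
... | false = countB-map f g xs

-- The map `e` is arbitrary because the recursion on `n` replaces it by `e ∘ suc`.
countB-subsets : ∀ {A : Set} m n (e : Fin n → A) (is : Vec ℕ m) (f : Vec (Fin n) m → Bool) (Φ : Word A → ℕ) →
  (∀ v → Increasing v → (if f v then 1 else 0) ≡ Φ (vzip (V.map e v) is)) →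
  countB f (subsets m n) ≡ choose (tabulate e) (toList is) Φ
countB-subsets zero n e [] f Φ p = p [] (λ ())
countB-subsets (suc m) zero e (i ∷ is) f Φ p = refl
countB-subsets (suc m) (suc n) e (i ∷ is) f Φ p =
  trans (countB-++ f (map _ (subsets m n)) _) (cong₂ _+_
    (trans (countB-map f _ (subsets m n))
      (countB-subsets m n (e ∘ suc) is _ _ λ v inc → trans (p _ (Increasing-cons v inc))
        (cong (λ w → Φ ((e zero , i) ∷ vzip w is)) (sym (V.map-∘ e Fin.suc v)))))
    (trans (countB-map f _ (subsets (suc m) n))
      (countB-subsets (suc m) n (e ∘ suc) (i ∷ is) _ Φ λ v inc → trans (p _ (Increasing-map v inc))
        (cong (λ w → Φ (vzip w (i ∷ is))) (sym (V.map-∘ e Fin.suc v))))))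

and-map⁻ : ∀ {B : Set} (g : B → Bool) xs → and (map g xs) ≡ true → ∀ {x} → x ∈ xs → g x ≡ true
and-map⁻ g (x ∷ xs) p y∈ with g x in gx
and-map⁻ g (x ∷ xs) p (here refl) | true = gx
and-map⁻ g (x ∷ xs) p (there y∈) | true = and-map⁻ g xs p y∈

and-map⁺ : ∀ {B : Set} (g : B → Bool) xs → (∀ x → g x ≡ true) → and (map g xs) ≡ true
and-map⁺ g [] p = refl
and-map⁺ g (x ∷ xs) p rewrite p x = and-map⁺ g xs p

==⇒≡ : ∀ b c → (b == c) ≡ true → b ≡ c
==⇒≡ false false _ = refl
==⇒≡ true true _ = refl

==-refl : ∀ b → (b == b) ≡ true
==-refl false = refl
==-refl true = refl

<ᵇ-flip : ∀ {m n} → m ≢ n → (m <ᵇ n) ≡ not (n <ᵇ m)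
<ᵇ-flip {m} {n} m≢n with <-cmp m n
... | tri< m<n _ _ rewrite <⇒<ᵇ≡true m<n | ≥⇒<ᵇ≡false (<⇒≤ m<n) = refl
... | tri≈ _ m≡n _ = ⊥-elim (m≢n m≡n)
... | tri> _ _ n<m rewrite <⇒<ᵇ≡true n<m | ≥⇒<ᵇ≡false (<⇒≤ n<m) = refl

perm-injective : ∀ {n} (π : Permutation′ n) {i j} → toℕ (π ⟨$⟩ʳ i) ≡ toℕ (π ⟨$⟩ʳ j) → i ≡ j
perm-injective π eq = trans (sym (inverseˡ π))
  (trans (cong (π ⟨$⟩ˡ_) (toℕ-injective eq)) (inverseˡ π))

-- The upper bound takes `e` to be the identity; the lower bound takes the layer index in the host,
-- so that points of one layer become equal letters.
module _ {A : Set} (_≺_ : A → A → Bool) {n N : ℕ} (rs : List ℕ) (τ : Permutation′ n) (σ : Permutation′ N)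
  (e : Fin N → A)
  (τ-layered : ∀ i → toℕ (τ ⟨$⟩ʳ i) ≡ layeredFn rs (toℕ i))
  (e-order : ∀ c d → (e c ≺ e d) ≡ (toℕ c <ᵇ toℕ d) ∧ (toℕ (σ ⟨$⟩ʳ c) <ᵇ toℕ (σ ⟨$⟩ʳ d))) where

  private
    is : Vec ℕ n
    is = V.tabulate (λ i → layerOf rs (toℕ i))

    τ< : Fin n → Fin n → Bool
    τ< j k = toℕ (τ ⟨$⟩ʳ j) <ᵇ toℕ (τ ⟨$⟩ʳ k)

    labels-τ : ∀ j k → (lookup is j <ᵇ lookup is k) ≡ (toℕ j <ᵇ toℕ k) ∧ τ< j k
    labels-τ j k rewrite V.lookup∘tabulate (λ i → layerOf rs (toℕ i)) j | V.lookup∘tabulate (λ i → layerOf rs (toℕ i)) k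
      | τ-layered j | τ-layered k = layerOf-<ᵇ rs (toℕ j) (toℕ k)

    module _ (v : Vec (Fin N) n) (inc : Increasing v) where

      σ< : Fin n → Fin n → Bool
      σ< j k = toℕ (σ ⟨$⟩ʳ lookup v j) <ᵇ toℕ (σ ⟨$⟩ʳ lookup v k)

      order-σ : ∀ j k → (lookup (V.map e v) j ≺ lookup (V.map e v) k) ≡ (toℕ j <ᵇ toℕ k) ∧ σ< j k
      order-σ j k rewrite V.lookup-map j e v | V.lookup-map k e v =
        trans (e-order (lookup v j) (lookup v k)) (cong (_∧ σ< j k) (inc j k))

      pattern⇒valid : patternAt τ σ v ≡ true → Valid _≺_ (vzip (V.map e v) is)
      pattern⇒valid p = All-vzip⁺ (V.map e v) is λ j → All-vzip⁺ (V.map e v) is λ k →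
        trans (order-σ j k) (trans (cong ((toℕ j <ᵇ toℕ k) ∧_) (same j k)) (sym (labels-τ j k)))
        where
        same : ∀ j k → σ< j k ≡ τ< j k
        same j k = ==⇒≡ (σ< j k) (τ< j k)
          (and-map⁻ _ (allFin n) (and-map⁻ _ (allFin n) p (∈-allFin j)) (∈-allFin k))

      valid⇒pattern : Valid _≺_ (vzip (V.map e v) is) → patternAt τ σ v ≡ true
      valid⇒pattern va = and-map⁺ _ (allFin n) λ j → and-map⁺ _ (allFin n) λ k →
        subst (λ b → (σ< j k == b) ≡ true) (same j k) (==-refl (σ< j k))
        where
        upper : ∀ j k → (toℕ j <ᵇ toℕ k) ∧ σ< j k ≡ (toℕ j <ᵇ toℕ k) ∧ τ< j k
        upper j k = trans (sym (order-σ j k))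
          (trans (All-vzip⁻ (V.map e v) is (All-vzip⁻ (V.map e v) is va j) k) (labels-τ j k))
        -- Validity speaks about the values only for `j < k`; the reverse comparison follows because
        -- permutations are injective.
        forward : ∀ j k → toℕ j < toℕ k → σ< j k ≡ τ< j k
        forward j k j<k = subst (λ b → b ∧ σ< j k ≡ b ∧ τ< j k) (<⇒<ᵇ≡true j<k) (upper j k)
        same : ∀ j k → σ< j k ≡ τ< j k
        same j k with <-cmp (toℕ j) (toℕ k)
        ... | tri< j<k _ _ = forward j k j<k
        ... | tri≈ _ j≡k _ rewrite toℕ-injective j≡k =
              trans (≥⇒<ᵇ≡false (≤-refl {toℕ (σ ⟨$⟩ʳ lookup v k)})) (sym (≥⇒<ᵇ≡false (≤-refl {toℕ (τ ⟨$⟩ʳ k)})))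
        ... | tri> _ j≢k k<j = trans (<ᵇ-flip σ≢) (trans (cong not (forward k j k<j)) (sym (<ᵇ-flip τ≢)))
          where
          τ≢ : toℕ (τ ⟨$⟩ʳ j) ≢ toℕ (τ ⟨$⟩ʳ k)
          τ≢ eq = j≢k (cong toℕ (perm-injective τ eq))
          v< : toℕ (lookup v k) < toℕ (lookup v j)
          v< = <ᵇ≡true⇒< (trans (inc k j) (<⇒<ᵇ≡true k<j))
          σ≢ : toℕ (σ ⟨$⟩ʳ lookup v j) ≢ toℕ (σ ⟨$⟩ʳ lookup v k)
          σ≢ eq = <-irrefl (cong toℕ (sym (perm-injective σ eq))) v<

      pattern-indicator : (if patternAt τ σ v then 1 else 0) ≡ indicator _≺_ (vzip (V.map e v) is)
      pattern-indicator with patternAt τ σ v in eq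
      ... | true = sym (indicator-yes _≺_ (pattern⇒valid eq))
      ... | false = sym (indicator-no _≺_ λ va → contra (trans (sym eq) (valid⇒pattern va)))
        where
        contra : false ≡ true → ⊥
        contra ()

  count≡choose : sum rs ≡ n →
    countB (patternAt τ σ) (subsets n N) ≡ choose (tabulate e) (labels 0 rs) (indicator _≺_)
  count≡choose eq = trans
    (countB-subsets n N e is (patternAt τ σ) (indicator _≺_) pattern-indicator)
    (cong (λ ls → choose (tabulate e) ls (indicator _≺_))
      (trans (toList-tabulate (layerOf rs) n)
        (trans (cong (applyUpTo (layerOf rs)) (sym eq)) (labels-layerOf 0 rs))))

-- Counting copies in a layered host from below

nC0≡1 : ∀ n → n C 0 ≡ 1
nC0≡1 n = trans (nCk≡nC[n∸k] {0} {n} z≤n) (nCn≡1 n)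

choose-++ʳ : ∀ {A : Set} P R is {Ψ : Word A → ℕ} → choose R is Ψ ≤ choose (P ++ R) is Ψ
choose-++ʳ [] R is = ≤-refl
choose-++ʳ (p ∷ P) R is = ≤-trans (choose-++ʳ P R is) (choose-cons p (P ++ R) is)

choose-++ˡ : ∀ {A : Set} P R is {Ψ : Word A → ℕ} → choose P is Ψ ≤ choose (P ++ R) is Ψ
choose-++ˡ P R [] = ≤-refl
choose-++ˡ [] R (i ∷ is) = z≤n
choose-++ˡ (p ∷ P) R (i ∷ is) = +-mono-≤ (choose-++ˡ P R is) (choose-++ˡ P R (i ∷ is))

choose-mono-All : ∀ {A : Set} {Q : A → Set} {Q′ : ℕ → Set} P is {Φ Ψ : Word A → ℕ} → All Q P → All Q′ is →
  (∀ f → All (λ (c , i) → Q c × Q′ i) f → Φ f ≤ Ψ f) → choose P is Φ ≤ choose P is Ψ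
choose-mono-All P [] _ _ p = p [] []
choose-mono-All [] (i ∷ is) _ _ p = z≤n
choose-mono-All (c ∷ P) (i ∷ is) (q ∷ qs) (q′ ∷ qs′) p = +-mono-≤
  (choose-mono-All P is qs qs′ (λ f r → p ((c , i) ∷ f) ((q , q′) ∷ r)))
  (choose-mono-All P (i ∷ is) qs (q′ ∷ qs′) p)

choose-replicate : ∀ {A : Set} (c : A) b p r R is {Ψ : Word A → ℕ} →
  (p C r) * choose R is (λ f → Ψ (replicate r (c , b) ++ f)) ≤ choose (replicate p c ++ R) (replicate r b ++ is) Ψ
choose-replicate c b p zero R is rewrite nC0≡1 p = ≤-trans (≤-reflexive (*-identityˡ _)) (choose-++ʳ (replicate p c) R is)
choose-replicate c b zero (suc r) R is rewrite k>n⇒nCk≡0 {0} {suc r} (s≤s z≤n) = z≤n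
choose-replicate c b (suc p) (suc r) R is {Ψ} = begin
  (suc p C suc r) * X                 ≡⟨ cong (_* X) (nCk+nC[k+1]≡[n+1]C[k+1] p r) ⟨
  (p C r + p C suc r) * X             ≡⟨ *-distribʳ-+ X (p C r) (p C suc r) ⟩
  (p C r) * X + (p C suc r) * X       ≤⟨ +-mono-≤ (choose-replicate c b p r R is) (choose-replicate c b p (suc r) R is) ⟩
  choose (replicate (suc p) c ++ R) (replicate (suc r) b ++ is) Ψ ∎
  where
  open ≤-Reasoning
  X = choose R is (λ f → Ψ (replicate (suc r) (c , b) ++ f))

-- The second summand takes no `c` at all; since `suc r` letters `b` are wanted, it is disjoint from
-- the first. Both follow Pascal's rule.
choose-layer : ∀ {A : Set} (c : A) b p r R is {Ψ : Word A → ℕ} →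
  (p C suc r) * choose R is (λ f → Ψ (replicate (suc r) (c , b) ++ f)) + choose R (replicate (suc r) b ++ is) Ψ ≤
  choose (replicate p c ++ R) (replicate (suc r) b ++ is) Ψ
choose-layer c b zero r R is rewrite k>n⇒nCk≡0 {0} {suc r} (s≤s z≤n) = ≤-refl
choose-layer c b (suc p) r R is {Ψ} = begin
  (suc p C suc r) * X + Y             ≡⟨ cong (λ t → t * X + Y) (nCk+nC[k+1]≡[n+1]C[k+1] p r) ⟨
  (p C r + p C suc r) * X + Y         ≡⟨ e (p C r) (p C suc r) X Y ⟩
  (p C r) * X + ((p C suc r) * X + Y) ≤⟨ +-mono-≤ (choose-replicate c b p r R is) (choose-layer c b p r R is) ⟩
  choose (replicate (suc p) c ++ R) (replicate (suc r) b ++ is) Ψ ∎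
  where
  open ≤-Reasoning
  X = choose R is (λ f → Ψ (replicate (suc r) (c , b) ++ f))
  Y = choose R (replicate (suc r) b ++ is) Ψ
  e : ∀ s t x y → (s + t) * x + y ≡ s * x + (t * x + y)
  e = solve-∀

-- Copies of the layered pattern rs in the layered permutation ps.
binomials : List ℕ → List ℕ → ℕ
binomials [] ps = 1
binomials (r ∷ rs) [] = 0
binomials (r ∷ rs) (p ∷ ps) = (p C r) * binomials rs ps + binomials (r ∷ rs) ps

∈-replicate⁻ : ∀ {A : Set} {x y : A} n → y ∈ replicate n x → y ≡ x
∈-replicate⁻ (suc n) (here eq) = eq
∈-replicate⁻ (suc n) (there y∈) = ∈-replicate⁻ n y∈

Valid-replicate-++ : ∀ c b r f → All (λ (d , i) → c < d × b < i) f → Valid _<ᵇ_ f → Valid _<ᵇ_ (replicate r (c , b) ++ f)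
Valid-replicate-++ c b r f above v = All.tabulate λ p∈ → All.tabulate λ q∈ →
  pair (∈-++⁻ (replicate r (c , b)) p∈) (∈-++⁻ (replicate r (c , b)) q∈)
  where
  pair : ∀ {p q} → p ∈ replicate r (c , b) ⊎ p ∈ f → q ∈ replicate r (c , b) ⊎ q ∈ f → Compatible _<ᵇ_ p q
  pair (inj₁ p∈) (inj₁ q∈) with refl ← ∈-replicate⁻ r p∈ | refl ← ∈-replicate⁻ r q∈ =
    trans (≥⇒<ᵇ≡false (≤-refl {c})) (sym (≥⇒<ᵇ≡false (≤-refl {b})))
  pair (inj₁ p∈) (inj₂ q∈) with refl ← ∈-replicate⁻ r p∈ with c<d , b<i ← All.lookup above q∈ =
    trans (<⇒<ᵇ≡true c<d) (sym (<⇒<ᵇ≡true b<i))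
  pair (inj₂ p∈) (inj₁ q∈) with refl ← ∈-replicate⁻ r q∈ with c<d , b<i ← All.lookup above p∈ =
    trans (≥⇒<ᵇ≡false (<⇒≤ c<d)) (sym (≥⇒<ᵇ≡false (<⇒≤ b<i)))
  pair (inj₂ p∈) (inj₂ q∈) = compatible _<ᵇ_ v p∈ q∈

binomials≤choose : ∀ c b rs ps → All (1 ≤_) rs → binomials rs ps ≤ choose (labels c ps) (labels b rs) (indicator _<ᵇ_)
binomials≤choose c b [] ps _ = ≤-reflexive (sym (indicator-yes _<ᵇ_ []))
binomials≤choose c b (r ∷ rs) [] _ = z≤n
binomials≤choose c b (suc r ∷ rs) (p ∷ ps) pos@(_ ∷ pos′) = begin
  (p C suc r) * binomials rs ps + binomials (suc r ∷ rs) ps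
    ≤⟨ +-mono-≤ (*-monoʳ-≤ (p C suc r) (≤-trans (binomials≤choose (suc c) (suc b) rs ps pos′)
         (choose-mono-All R is (labels-≥ (suc c) ps) (labels-≥ (suc b) rs)
           (λ f above → indicator-mono _<ᵇ_ (Valid-replicate-++ c b (suc r) f above)))))
         (binomials≤choose (suc c) b (suc r ∷ rs) ps pos) ⟩
  (p C suc r) * choose R is (λ f → indicator _<ᵇ_ (replicate (suc r) (c , b) ++ f)) + choose R (replicate (suc r) b ++ is) (indicator _<ᵇ_)
    ≤⟨ choose-layer c b p r R is ⟩
  choose (replicate p c ++ R) (replicate (suc r) b ++ is) (indicator _<ᵇ_) ∎
  where
  open ≤-Reasoning
  R = labels (suc c) ps
  is = labels (suc b) rs

binomials-singletons : ∀ a m ls ps → (m C a) * binomials ls ps ≤ binomials (replicate a 1 ++ ls) (replicate m 1 ++ ps)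
binomials-singletons zero m ls ps rewrite nC0≡1 m = ≤-trans (≤-reflexive (*-identityˡ _)) (pass m ls)
  where
  pass : ∀ m ls → binomials ls ps ≤ binomials ls (replicate m 1 ++ ps)
  pass zero ls = ≤-refl
  pass (suc m) [] = ≤-refl
  pass (suc m) (l ∷ ls) = ≤-trans (pass m (l ∷ ls)) (m≤n+m _ _)
binomials-singletons (suc a) zero ls ps rewrite k>n⇒nCk≡0 {0} {suc a} (s≤s z≤n) = z≤n
binomials-singletons (suc a) (suc m) ls ps = begin
  (suc m C suc a) * X                 ≡⟨ cong (_* X) (nCk+nC[k+1]≡[n+1]C[k+1] m a) ⟨
  (m C a + m C suc a) * X             ≡⟨ *-distribʳ-+ X (m C a) (m C suc a) ⟩
  (m C a) * X + (m C suc a) * X       ≤⟨ +-mono-≤ (binomials-singletons a m ls ps) (binomials-singletons (suc a) m ls ps) ⟩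
  Y + Z                               ≡⟨ cong (_+ Z) (*-identityˡ Y) ⟨
  (1 C 1) * Y + Z                     ∎
  where
  open ≤-Reasoning
  X = binomials ls ps
  Y = binomials (replicate a 1 ++ ls) (replicate m 1 ++ ps)
  Z = binomials (replicate (suc a) 1 ++ ls) (replicate m 1 ++ ps)

-- The falling factorial, which links binomial coefficients to powers.
fall : ℕ → ℕ → ℕ
fall n zero = 1
fall zero (suc k) = 0
fall (suc n) (suc k) = suc n * fall n k

fall-suc : ∀ n k → fall n (suc k) + k * fall n k ≡ n * fall n k
fall-suc zero zero = refl
fall-suc zero (suc k) = *-zeroʳ (suc k)
fall-suc (suc n) zero = +-identityʳ _
fall-suc (suc n) (suc k) = trans (e n k (fall n (suc k)) (fall n k))
  (cong (λ t → suc n * (fall n k + t)) (fall-suc n k))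
  where
  e : ∀ n k x y → suc n * x + suc k * (suc n * y) ≡ suc n * (y + (x + k * y))
  e = solve-∀

C-fall : ∀ n k → (n C k) * k ! ≡ fall n k
C-fall n zero = trans (*-identityʳ (n C 0)) (nC0≡1 n)
C-fall zero (suc k) rewrite k>n⇒nCk≡0 {0} {suc k} (s≤s z≤n) = refl
C-fall (suc n) (suc k) = begin
  (suc n C suc k) * (suc k * k !)               ≡⟨ cong (_* (suc k * k !)) (nCk+nC[k+1]≡[n+1]C[k+1] n k) ⟨
  (n C k + n C suc k) * (suc k * k !)           ≡⟨ e₁ (n C k) (n C suc k) (suc k) (k !) ⟩
  suc k * ((n C k) * k !) + (n C suc k) * suc k ! ≡⟨ cong₂ (λ s t → suc k * s + t) (C-fall n k) (C-fall n (suc k)) ⟩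
  suc k * fall n k + fall n (suc k)             ≡⟨ e₂ k (fall n k) (fall n (suc k)) ⟩
  fall n k + (fall n (suc k) + k * fall n k)    ≡⟨ cong (fall n k +_) (fall-suc n k) ⟩
  suc n * fall n k                              ∎
  where
  open ≡-Reasoning
  e₁ : ∀ x y s t → (x + y) * (s * t) ≡ s * (x * t) + y * (s * t)
  e₁ = solve-∀
  e₂ : ∀ k x y → suc k * x + y ≡ x + (y + k * x)
  e₂ = solve-∀

fall≤^ : ∀ n k → fall n k ≤ n ^ k
fall≤^ n zero = ≤-refl
fall≤^ zero (suc k) = z≤n
fall≤^ (suc n) (suc k) = *-monoʳ-≤ (suc n) (≤-trans (fall≤^ n k) (^-monoˡ-≤ k (n≤1+n n)))

^≤fall : ∀ n k → (n ∸ k) ^ k ≤ fall n k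
^≤fall n zero = ≤-refl
^≤fall zero (suc k) = z≤n
^≤fall (suc n) (suc k) = *-mono-≤ (≤-trans (m∸n≤m n k) (n≤1+n n)) (^≤fall n k)

-- Bernoulli's inequality; truncated subtraction is harmless since `N ≤ m + (N ∸ m)` always holds.
bernoulli : ∀ n m N → N ^ n ≤ (N ∸ m) ^ n + n * (m * N ^ pred n)
bernoulli zero m N = ≤-refl
bernoulli (suc zero) m N = ≤-trans (≤-reflexive (*-identityʳ N)) (≤-trans (m≤n+m∸n N m) (≤-reflexive (e m (N ∸ m))))
  where
  e : ∀ m d → m + d ≡ d * 1 + 1 * (m * 1)
  e = solve-∀
bernoulli (suc n@(suc n′)) m N = begin
  N * N ^ n                                         ≤⟨ *-monoʳ-≤ N (bernoulli n m N) ⟩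
  N * (d ^ n + n * (m * N ^ n′))                    ≡⟨ e₁ N (d ^ n) n m (N ^ n′) ⟩
  N * d ^ n + n * (m * N ^ n)                       ≤⟨ +-monoˡ-≤ _ (*-monoˡ-≤ (d ^ n) (m≤n+m∸n N m)) ⟩
  (m + d) * d ^ n + n * (m * N ^ n)                 ≡⟨ e₂ m d (d ^ n) (n * (m * N ^ n)) ⟩
  d * d ^ n + (m * d ^ n + n * (m * N ^ n))         ≤⟨ +-monoʳ-≤ (d * d ^ n) (+-monoˡ-≤ _ (*-monoʳ-≤ m (^-monoˡ-≤ n (m∸n≤m N m)))) ⟩
  d * d ^ n + (m * N ^ n + n * (m * N ^ n))         ∎
  where
  open ≤-Reasoning
  d = N ∸ m
  e₁ : ∀ N D n m X → N * (D + n * (m * X)) ≡ N * D + n * (m * (N * X))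
  e₁ = solve-∀
  e₂ : ∀ m d D r → (m + d) * D + r ≡ d * D + (m * D + r)
  e₂ = solve-∀

-- Both bounds and the limit

_!ₗ : List ℕ → ℕ
ls !ₗ = product (map _! ls)

singletons : ℕ → List ℕ → List ℕ
singletons a ls = replicate a 1 ++ ls

sum-singletons : ∀ a ls → sum (singletons a ls) ≡ a + sum ls
sum-singletons zero ls = refl
sum-singletons (suc a) ls = cong suc (sum-singletons a ls)

!ₗ-singletons : ∀ a ls → singletons a ls !ₗ ≡ ls !ₗ
!ₗ-singletons zero ls = refl
!ₗ-singletons (suc a) ls = trans (*-identityˡ _) (!ₗ-singletons a ls)

singletons-pos : ∀ a {ls} → All (1 ≤_) ls → All (1 ≤_) (singletons a ls)
singletons-pos zero pos = pos
singletons-pos (suc a) pos = ≤-refl ∷ singletons-pos a pos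

sum-ones : ∀ {A : Set} (P : List A) → sum (map proj₂ (ones P)) ≡ length P
sum-ones [] = refl
sum-ones (_ ∷ P) = cong suc (sum-ones P)

ones-pos : ∀ {A : Set} (P : List A) → All (λ p → 0 < proj₂ p) (ones P)
ones-pos [] = []
ones-pos (_ ∷ P) = s≤s z≤n ∷ ones-pos P

∧-true : ∀ {b c} → b ∧ c ≡ true → b ≡ true × c ≡ true
∧-true {true} {true} _ = refl , refl

module _ {N : ℕ} (σ : Permutation′ N) where

  _≺_ : Fin N → Fin N → Bool
  c ≺ d = (toℕ c <ᵇ toℕ d) ∧ (toℕ (σ ⟨$⟩ʳ c) <ᵇ toℕ (σ ⟨$⟩ʳ d))

  ≺-irrefl : ∀ c → (c ≺ c) ≡ false
  ≺-irrefl c rewrite ≥⇒<ᵇ≡false (≤-refl {toℕ c}) = refl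

  ≺-trans : ∀ {c d e} → (c ≺ d) ≡ true → (d ≺ e) ≡ true → (c ≺ e) ≡ true
  ≺-trans {c} {d} {e} p q with p₁ , p₂ ← ∧-true p | q₁ , q₂ ← ∧-true q = cong₂ _∧_
    (<⇒<ᵇ≡true (<-trans (<ᵇ≡true⇒< {toℕ c} {toℕ d} p₁) (<ᵇ≡true⇒< {toℕ d} {toℕ e} q₁)))
    (<⇒<ᵇ≡true (<-trans (<ᵇ≡true⇒< {toℕ (σ ⟨$⟩ʳ c)} {toℕ (σ ⟨$⟩ʳ d)} p₂)
                        (<ᵇ≡true⇒< {toℕ (σ ⟨$⟩ʳ d)} {toℕ (σ ⟨$⟩ʳ e)} q₂)))

copies : ∀ {n N} → Permutation′ n → Permutation′ N → ℕ
copies {n} {N} τ σ = countB (patternAt τ σ) (subsets n N)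

Layered : ∀ {n} → List ℕ → Permutation′ n → Set
Layered rs τ = ∀ i → toℕ (τ ⟨$⟩ʳ i) ≡ layeredFn rs (toℕ i)

layeredPerm-layered : ∀ rs {N} (s≤N : sum rs ≤ N) → Layered rs (layeredPerm rs s≤N)
layeredPerm-layered rs s≤N i = toℕ-fromℕ< _

copies-upper : ∀ a ls {n N} → Sorted ls → All (1 ≤_) ls → All (a ≤_) ls → length ls ≤ excess a →
  a + sum ls ≡ n → (τ : Permutation′ n) → Layered (singletons a ls) τ → (σ : Permutation′ N) →
  copies τ σ * (n ^ n * a ! * ls !ₗ) ≤ a ^ a * Πself ls * N ^ n
copies-upper a ls {n} {N} s pos a≤ k≤c refl τ τ-layered σ = begin
  copies τ σ * (n ^ n * a ! * ls !ₗ)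
    ≡⟨ e (copies τ σ) (n ^ n) (a !) (ls !ₗ) ⟩
  a ! * (ls !ₗ * copies τ σ) * n ^ n
    ≡⟨ cong₂ (λ f c → a ! * (f * c) * n ^ n) (sym (!ₗ-singletons a ls))
        (count≡choose (_≺_ σ) rs τ σ id τ-layered (λ _ _ → refl) (sum-singletons a ls)) ⟩
  a ! * (rs !ₗ * choose pts (labels 0 rs) (indicator (_≺_ σ))) * n ^ n
    ≤⟨ *-monoˡ-≤ (n ^ n) (*-monoʳ-≤ (a !) (≤-trans (choose≤place pts 0 rs (indicator-sym (_≺_ σ))) below)) ⟩
  a ! * layers rs ws * n ^ n
    ≤⟨ *-monoˡ-≤ (n ^ n) (layers≤blocks a ls ws) ⟩
  blocks 0 a ls ws * n ^ n
    ≤⟨ blocks-bound (length ws) 0 a ls ws ≤-refl s pos a≤ k≤c ⟩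
  a ^ a * Πself ls * sum ws ^ n
    ≡⟨ cong (λ t → a ^ a * Πself ls * t ^ n) (trans total (trans (sum-ones pts) (length-tabulate id))) ⟩
  a ^ a * Πself ls * N ^ n ∎
  where
  open ≤-Reasoning
  rs = singletons a ls
  pts = tabulate {n = N} id
  chained : ∃ λ ws → sum ws ≡ sum (map proj₂ (ones pts)) ×
    place (ones pts) (labels 0 rs) (indicator (_≺_ σ)) ≤ layers rs ws
  chained = place≤layers (_≺_ σ) (≺-irrefl σ) (λ {c} {d} {e} → ≺-trans σ {c} {d} {e}) N 0 rs (ones pts)
    (≤-reflexive (trans (length-map _ pts) (length-tabulate id))) (ones-pos pts) (singletons-pos a pos)
  ws = proj₁ chained
  total = proj₁ (proj₂ chained)
  below = proj₂ (proj₂ chained)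
  e : ∀ k p q r → k * (p * q * r) ≡ q * (r * k) * p
  e = solve-∀

binomial-self : ∀ q l → l ^ l * (q ∸ 1) ^ l ≤ (q * l C l) * l !
binomial-self q l = begin
  l ^ l * (q ∸ 1) ^ l     ≡⟨ *-comm (l ^ l) _ ⟩
  (q ∸ 1) ^ l * l ^ l     ≡⟨ ^-distribʳ-* (q ∸ 1) l l ⟨
  ((q ∸ 1) * l) ^ l       ≡⟨ cong (_^ l) (trans (*-distribʳ-∸ l q 1) (cong (q * l ∸_) (*-identityˡ l))) ⟩
  (q * l ∸ l) ^ l         ≤⟨ ^≤fall (q * l) l ⟩
  fall (q * l) l          ≡⟨ C-fall (q * l) l ⟨
  (q * l C l) * l !       ∎
  where open ≤-Reasoning

binomials-self : ∀ q ls → Πself ls * (q ∸ 1) ^ sum ls ≤ binomials ls (map (q *_) ls) * ls !ₗ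
binomials-self q [] = ≤-refl
binomials-self q (l ∷ ls) = begin
  l ^ l * Πself ls * (q ∸ 1) ^ (l + sum ls)
    ≡⟨ cong (l ^ l * Πself ls *_) (^-distribˡ-+-* (q ∸ 1) l (sum ls)) ⟩
  l ^ l * Πself ls * ((q ∸ 1) ^ l * (q ∸ 1) ^ sum ls)
    ≡⟨ e₁ (l ^ l) (Πself ls) ((q ∸ 1) ^ l) ((q ∸ 1) ^ sum ls) ⟩
  (l ^ l * (q ∸ 1) ^ l) * (Πself ls * (q ∸ 1) ^ sum ls)
    ≤⟨ *-mono-≤ (binomial-self q l) (binomials-self q ls) ⟩
  (q * l C l) * l ! * (B * ls !ₗ)
    ≡⟨ e₁ (q * l C l) (l !) B (ls !ₗ) ⟩
  (q * l C l) * B * (l ! * ls !ₗ)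
    ≤⟨ *-monoˡ-≤ (l ! * ls !ₗ) (m≤m+n ((q * l C l) * B) _) ⟩
  binomials (l ∷ ls) (map (q *_) (l ∷ ls)) * (l ! * ls !ₗ) ∎
  where
  open ≤-Reasoning
  B = binomials ls (map (q *_) ls)
  e₁ : ∀ w x y z → w * x * (y * z) ≡ w * y * (x * z)
  e₁ = solve-∀

sum-map-* : ∀ q ls → sum (map (q *_) ls) ≡ q * sum ls
sum-map-* q [] = sym (*-zeroʳ q)
sum-map-* q (l ∷ ls) = trans (cong (q * l +_) (sum-map-* q ls)) (sym (*-distribˡ-+ q l (sum ls)))

-- The host is the pattern with its antilayer and each layer enlarged `q` times; the points beyond
-- `q * n` are fixed and can only add copies. Each block of size `l` contributes at least
-- `((q ∸ 1) * l) ^ l` divided by `l !`.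
copies-lower : ∀ a ls {n N} q → All (1 ≤_) ls → a + sum ls ≡ n → q * n ≤ N →
  (τ : Permutation′ n) → Layered (singletons a ls) τ →
  ∃ λ (σ : Permutation′ N) → a ^ a * Πself ls * (q ∸ 1) ^ n ≤ copies τ σ * (a ! * ls !ₗ)
copies-lower a ls {n} {N} q pos refl qn≤N τ τ-layered = σ , (begin
  a ^ a * Πself ls * (q ∸ 1) ^ (a + sum ls)
    ≡⟨ cong (a ^ a * Πself ls *_) (^-distribˡ-+-* (q ∸ 1) a (sum ls)) ⟩
  a ^ a * Πself ls * ((q ∸ 1) ^ a * (q ∸ 1) ^ sum ls)
    ≡⟨ e₁ (a ^ a) (Πself ls) ((q ∸ 1) ^ a) ((q ∸ 1) ^ sum ls) ⟩
  a ^ a * (q ∸ 1) ^ a * (Πself ls * (q ∸ 1) ^ sum ls)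
    ≤⟨ *-mono-≤ (binomial-self q a) (binomials-self q ls) ⟩
  (q * a C a) * a ! * (binomials ls (map (q *_) ls) * ls !ₗ)
    ≡⟨ e₁ (q * a C a) (a !) _ (ls !ₗ) ⟩
  (q * a C a) * binomials ls (map (q *_) ls) * (a ! * ls !ₗ)
    ≤⟨ *-monoˡ-≤ (a ! * ls !ₗ) count ⟩
  copies τ σ * (a ! * ls !ₗ) ∎)
  where
  open ≤-Reasoning
  rs = singletons a ls
  ps = singletons (q * a) (map (q *_) ls)
  sum-ps : sum ps ≡ q * n
  sum-ps = trans (sum-singletons (q * a) _) (trans (cong (q * a +_) (sum-map-* q ls)) (sym (*-distribˡ-+ q a (sum ls))))
  sum≤N : sum ps ≤ N
  sum≤N = ≤-trans (≤-reflexive sum-ps) qn≤N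
  σ = layeredPerm ps sum≤N
  e : Fin N → ℕ
  e i = layerOf ps (toℕ i)
  e-order : ∀ c d → (e c <ᵇ e d) ≡ (toℕ c <ᵇ toℕ d) ∧ (toℕ (σ ⟨$⟩ʳ c) <ᵇ toℕ (σ ⟨$⟩ʳ d))
  e-order c d = trans (layerOf-<ᵇ ps (toℕ c) (toℕ d))
    (sym (cong₂ (λ x y → (toℕ c <ᵇ toℕ d) ∧ (x <ᵇ y)) (layeredPerm-layered ps sum≤N c) (layeredPerm-layered ps sum≤N d)))
  points : ∃ λ rest → labels 0 ps ++ rest ≡ tabulate e
  points with t , eq ← m≤n⇒∃[o]m+o≡n sum≤N = applyUpTo (λ i → layerOf ps (sum ps + i)) t ,
    trans (cong (_++ applyUpTo (λ i → layerOf ps (sum ps + i)) t) (sym (labels-layerOf 0 ps)))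
      (trans (sym (applyUpTo-+ (layerOf ps) (sum ps) t))
        (trans (cong (applyUpTo (layerOf ps)) eq) (sym (tabulate-toℕ (layerOf ps) N))))
  count : (q * a C a) * binomials ls (map (q *_) ls) ≤ copies τ σ
  count = begin
    (q * a C a) * binomials ls (map (q *_) ls)             ≤⟨ binomials-singletons a (q * a) ls (map (q *_) ls) ⟩
    binomials rs ps                                        ≤⟨ binomials≤choose 0 0 rs ps (singletons-pos a pos) ⟩
    choose (labels 0 ps) (labels 0 rs) (indicator _<ᵇ_)    ≤⟨ choose-++ˡ (labels 0 ps) (proj₁ points) (labels 0 rs) ⟩
    choose (labels 0 ps ++ proj₁ points) (labels 0 rs) (indicator _<ᵇ_) ≡⟨ cong (λ P → choose P (labels 0 rs) (indicator _<ᵇ_)) (proj₂ points) ⟩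
    choose (tabulate e) (labels 0 rs) (indicator _<ᵇ_)     ≡⟨ count≡choose _<ᵇ_ rs τ σ e τ-layered e-order (sum-singletons a ls) ⟨
    copies τ σ                                             ∎
  e₁ : ∀ w x y z → w * x * (y * z) ≡ w * y * (x * z)
  e₁ = solve-∀

-- From counts to densities and the limit

fall-large : ∀ n E N → 1 ≤ n → n * n + E < N → E * N ^ pred n < fall N n
fall-large n@(suc n′) E N _ big = +-cancelʳ-≤ (n * n * X) _ _ (begin
  suc (E * X) + n * n * X       ≤⟨ +-monoˡ-≤ (n * n * X) (+-monoˡ-≤ (E * X) X≥1) ⟩
  X + E * X + n * n * X         ≡⟨ e n E X ⟩
  suc (n * n + E) * X           ≤⟨ *-monoˡ-≤ X big ⟩
  N * X                         ≤⟨ bernoulli n n N ⟩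
  (N ∸ n) ^ n + n * (n * X)     ≤⟨ +-mono-≤ (^≤fall N n) (≤-reflexive (sym (*-assoc n n X))) ⟩
  fall N n + n * n * X          ∎)
  where
  open ≤-Reasoning
  X = N ^ n′
  X≥1 : 1 ≤ X
  X≥1 = >-nonZero⁻¹ X {{m^n≢0 N n′ {{>-nonZero (≤-trans (s≤s z≤n) big)}}}}
  e : ∀ n E X → X + E * X + n * n * X ≡ suc (n * n + E) * X
  e = solve-∀

-- With `K` copies, the two margins are the cross-multiplied forms of K / c < A / B + 1 / d and A /
-- B < K / c + 1 / d. The error terms have degree n - 1 in `N`, so `gap` absorbs them.
module _ {n : ℕ} (1≤n : 1 ≤ n) (A′ B d N : ℕ) (1≤B : 1 ≤ B)
  (big : n * n + n ! * A′ * d * (n * (2 * n)) < N) where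

  private
    open ≤-Reasoning
    A = n ! * A′
    X = N ^ pred n
    P = fall N n
    c = N C n

    gap : A * d * (n * (2 * n)) * X < B * P
    gap = begin-strict
      A * d * (n * (2 * n)) * X <⟨ fall-large n (A * d * (n * (2 * n))) N 1≤n big ⟩
      P                         ≡⟨ *-identityˡ P ⟨
      1 * P                     ≤⟨ *-monoˡ-≤ P 1≤B ⟩
      B * P                     ∎

    clear-factorial : ∀ {s t} → s * n ! < t * n ! → s < t
    clear-factorial {s} {t} = *-cancelʳ-< (n !) s t

  upper-margin : ∀ K → K * B ≤ A′ * N ^ n → K * (B * d) < (A * d + B) * c
  upper-margin K h = clear-factorial (begin-strict
    K * (B * d) * n !                     ≡⟨ e₁ K B d (n !) ⟩
    K * B * (n ! * d)                     ≤⟨ *-monoˡ-≤ (n ! * d) h ⟩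
    A′ * N ^ n * (n ! * d)                ≡⟨ e₂ A′ (N ^ n) (n !) d ⟩
    A * d * N ^ n                         ≤⟨ *-monoʳ-≤ (A * d) (≤-trans (bernoulli n n N) (+-mono-≤ (^≤fall N n) (*-monoʳ-≤ n (*-monoˡ-≤ X (m≤m+n n (n + 0)))))) ⟩
    A * d * (P + n * (2 * n * X))         ≡⟨ e₃ (A * d) P n X ⟩
    A * d * P + A * d * (n * (2 * n)) * X <⟨ +-monoʳ-< (A * d * P) gap ⟩
    A * d * P + B * P                     ≡⟨ *-distribʳ-+ P (A * d) B ⟨
    (A * d + B) * P                       ≡⟨ cong ((A * d + B) *_) (C-fall N n) ⟨
    (A * d + B) * (c * n !)               ≡⟨ *-assoc (A * d + B) c (n !) ⟨
    (A * d + B) * c * n !                 ∎)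
    where
    e₁ : ∀ K B d f → K * (B * d) * f ≡ K * B * (f * d)
    e₁ = solve-∀
    e₂ : ∀ A N f d → A * N * (f * d) ≡ f * A * d * N
    e₂ = solve-∀
    e₃ : ∀ Ad P n X → Ad * (P + n * (2 * n * X)) ≡ Ad * P + Ad * (n * (2 * n)) * X
    e₃ = solve-∀

  lower-margin : ∀ K → A′ * (N ∸ 2 * n) ^ n ≤ K * B → A * (c * d) < (K * d + c) * B
  lower-margin K h = clear-factorial (begin-strict
    A * (c * d) * n !                     ≡⟨ e₁ A c d (n !) ⟩
    A * d * (c * n !)                     ≡⟨ cong (A * d *_) (C-fall N n) ⟩
    A * d * P                             ≤⟨ *-monoʳ-≤ (A * d) (≤-trans (fall≤^ N n) (bernoulli n (2 * n) N)) ⟩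
    A * d * ((N ∸ 2 * n) ^ n + n * (2 * n * X)) ≡⟨ e₂ (n !) A′ d ((N ∸ 2 * n) ^ n) n X ⟩
    A′ * (N ∸ 2 * n) ^ n * (n ! * d) + A * d * (n * (2 * n)) * X
      <⟨ +-mono-≤-< (*-monoˡ-≤ (n ! * d) h) gap ⟩
    K * B * (n ! * d) + B * P             ≡⟨ cong (λ p → K * B * (n ! * d) + B * p) (C-fall N n) ⟨
    K * B * (n ! * d) + B * (c * n !)     ≡⟨ e₃ K B (n !) d c ⟩
    (K * d + c) * B * n !                 ∎)
    where
    e₁ : ∀ A c d f → A * (c * d) * f ≡ A * d * (c * f)
    e₁ = solve-∀
    e₂ : ∀ f A d M n X → f * A * d * (M + n * (2 * n * X)) ≡ A * M * (f * d) + f * A * d * (n * (2 * n)) * X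
    e₂ = solve-∀
    e₃ : ∀ K B f d c → K * B * (f * d) + B * (c * f) ≡ (K * d + c) * B * f
    e₃ = solve-∀

-- A positive rational is at least the reciprocal of its denominator, so `ε` enters the integer
-- inequalities only through `↧ₙ ε`.
frac-<-+ : ∀ {K c A B} ε → 0ℚ <ℚ ε → 1 ≤ c → 1 ≤ B → K * (B * ↧ₙ ε) < (A * ↧ₙ ε + B) * c →
  frac K c <ℚ frac A B +ℚ ε
frac-<-+ {K} {suc c} {A} {suc b} ε@(mkℚ +[1+ p ] d _) _ _ _ h =
  ℚ.toℚᵘ-cancel-< (ℚᵘ.<-respˡ-≃ (ℚᵘ.≃-sym (ℚ.toℚᵘ-fromℚᵘ (mkℚᵘ (ℤ.+ K) c)))
    (ℚᵘ.<-respʳ-≃ (ℚᵘ.≃-sym (ℚᵘ.≃-trans (ℚ.toℚᵘ-homo-+ (frac A (suc b)) ε)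
        (ℚᵘ.+-congˡ (toℚᵘ ε) (ℚ.toℚᵘ-fromℚᵘ (mkℚᵘ (ℤ.+ A) b)))))
      (*<* (subst₂ ℤ._<_ (ℤ.pos-* K (suc b * suc d)) rhs (+<+ h′)))))
  where
  h′ : K * (suc b * suc d) < (A * suc d + suc p * suc b) * suc c
  h′ = ≤-trans h (*-monoˡ-≤ (suc c) (+-monoʳ-≤ (A * suc d) (m≤m+n (suc b) (p * suc b))))
  rhs : ℤ.+ ((A * suc d + suc p * suc b) * suc c) ≡ (ℤ.+ A ℤ.* ℤ.+ suc d ℤ.+ ℤ.+ suc p ℤ.* ℤ.+ suc b) ℤ.* ℤ.+ suc c
  rhs = trans (ℤ.pos-* (A * suc d + suc p * suc b) (suc c))
    (cong (ℤ._* ℤ.+ suc c) (trans (ℤ.pos-+ (A * suc d) (suc p * suc b)) (cong₂ ℤ._+_ (ℤ.pos-* A (suc d)) (ℤ.pos-* (suc p) (suc b)))))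
frac-<-+ (mkℚ ℤ.+0 _ _) (ℚ.*<* (+<+ ()))
frac-<-+ (mkℚ ℤ.-[1+ _ ] _ _) (ℚ.*<* ())

<+⇒-< : ∀ p q ε → p <ℚ q +ℚ ε → p - ε <ℚ q
<+⇒-< p q ε h = subst (p - ε <ℚ_)
  (trans (ℚ.+-assoc q ε (-ℚ ε)) (trans (cong (q +ℚ_) (ℚ.+-inverseʳ ε)) (ℚ.+-identityʳ q)))
  (ℚ.+-monoˡ-< (-ℚ ε) h)

sum-toList : ∀ {k} (ℓ : Vec ℕ k) → sum (toList ℓ) ≡ sumV ℓ
sum-toList [] = refl
sum-toList (l ∷ ℓ) = cong (l +_) (sum-toList ℓ)

product-toList : ∀ {k} (f : ℕ → ℕ) (ℓ : Vec ℕ k) → product (map f (toList ℓ)) ≡ prodV (V.map f ℓ)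
product-toList f [] = refl
product-toList f (l ∷ ℓ) = cong (f l *_) (product-toList f ℓ)

All-toList : ∀ {k} {P : ℕ → Set} (ℓ : Vec ℕ k) → (∀ i → P (lookup ℓ i)) → All P (toList ℓ)
All-toList [] p = []
All-toList (l ∷ ℓ) p = p zero ∷ All-toList ℓ (p ∘ suc)

Sorted-toList : ∀ {k} (ℓ : Vec ℕ k) → (∀ i j → i ≤ᶠ j → lookup ℓ i ≤ lookup ℓ j) → Sorted (toList ℓ)
Sorted-toList [] p = []
Sorted-toList (l ∷ ℓ) p = All-toList ℓ (λ i → p zero (suc i) z≤n) ∷ Sorted-toList ℓ (λ i j i≤j → p (suc i) (suc j) (s≤s i≤j))

!ₗ-pos : ∀ ls → 1 ≤ ls !ₗ
!ₗ-pos [] = ≤-refl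
!ₗ-pos (l ∷ ls) = *-mono-≤ (1≤n! l) (!ₗ-pos ls)

-- Rounding `N` down to a multiple of `n` loses less than `n`, and passing from the quotient to its
-- predecessor loses another `n`; hence the `2 * n` in the margins.
quotient-large : ∀ N n .{{_ : NonZero n}} → N ∸ 2 * n ≤ n * (N / n ∸ 1)
quotient-large N n = begin
  N ∸ 2 * n                     ≤⟨ ∸-monoˡ-≤ (2 * n) N≤ ⟩
  (n + N / n * n) ∸ (n + (n + 0)) ≡⟨ [m+n]∸[m+o]≡n∸o n (N / n * n) (n + 0) ⟩
  N / n * n ∸ 1 * n             ≡⟨ *-distribʳ-∸ n (N / n) 1 ⟨
  (N / n ∸ 1) * n               ≡⟨ *-comm (N / n ∸ 1) n ⟩
  n * (N / n ∸ 1)               ∎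
  where
  open ≤-Reasoning
  N≤ : N ≤ n + N / n * n
  N≤ = ≤-trans (≤-reflexive (m≡m%n+[m/n]*n N n)) (+-monoˡ-≤ (N / n * n) (<⇒≤ (m%n<n N n)))

packing : ∀ a ls {n} → 1 ≤ a → Sorted ls → All (a ≤_) ls → length ls ≤ excess a → a + sum ls ≡ n →
  (τ : Permutation′ n) → Layered (singletons a ls) τ → (ε : ℚ) → 0ℚ <ℚ ε →
  let α = frac (n ! * (a ^ a) * Πself ls) ((n ^ n) * (a !) * ls !ₗ) in
  Σ ℕ λ N₀ → (N : ℕ) → N₀ ≤ N →
    ((σ : Permutation′ N) → density τ σ <ℚ (α +ℚ ε)) × Σ (Permutation′ N) (λ σ → (α - ε) <ℚ density τ σ)
packing a ls {n} 1≤a s a≤ k≤c eq τ τ-layered ε ε>0 = suc bound , λ N N₀≤N → above N N₀≤N , below N N₀≤N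
  where
  A′ = a ^ a * Πself ls
  A = n ! * (a ^ a) * Πself ls
  B = (n ^ n) * (a !) * ls !ₗ
  d = ↧ₙ ε
  bound = n * n + n ! * A′ * d * (n * (2 * n))
  pos : All (1 ≤_) ls
  pos = All.map (≤-trans 1≤a) a≤
  1≤n : 1 ≤ n
  1≤n = ≤-trans 1≤a (≤-trans (m≤m+n a (sum ls)) (≤-reflexive eq))
  1≤B : 1 ≤ B
  1≤B = *-mono-≤ (*-mono-≤ (>-nonZero⁻¹ (n ^ n) {{n^n≢0 n}}) (1≤n! a)) (!ₗ-pos ls)
  A≡ : n ! * A′ ≡ A
  A≡ = sym (*-assoc (n !) (a ^ a) (Πself ls))
  1≤C : ∀ N → suc bound ≤ N → 1 ≤ N C n
  1≤C N big = n≢0⇒n>0 λ C≡0 → <-irrefl refl (begin-strict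
    0                          ≤⟨ z≤n ⟩
    n ! * A′ * d * (n * (2 * n)) * N ^ pred n <⟨ fall-large n (n ! * A′ * d * (n * (2 * n))) N 1≤n big ⟩
    fall N n                   ≡⟨ C-fall N n ⟨
    (N C n) * n !              ≡⟨ cong (_* n !) C≡0 ⟩
    0                          ∎)
    where open ≤-Reasoning
  above : ∀ N → suc bound ≤ N → (σ : Permutation′ N) → density τ σ <ℚ frac A B +ℚ ε
  above N big σ = frac-<-+ ε ε>0 (1≤C N big) 1≤B
    (subst (λ A → copies τ σ * (B * d) < (A * d + B) * (N C n)) A≡
      (upper-margin 1≤n A′ B (d) N 1≤B big (copies τ σ) (copies-upper a ls s pos a≤ k≤c eq τ τ-layered σ)))
  below : ∀ N → suc bound ≤ N → Σ (Permutation′ N) λ σ → frac A B - ε <ℚ density τ σ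
  below N big = σ ,
    <+⇒-< (frac A B) (density τ σ) ε (frac-<-+ ε ε>0 1≤B (1≤C N big)
      (subst (λ A → A * ((N C n) * d) < (copies τ σ * d + N C n) * B) A≡
        (lower-margin 1≤n A′ B (d) N 1≤B big (copies τ σ) (begin
          A′ * (N ∸ 2 * n) ^ n               ≤⟨ *-monoʳ-≤ A′ (^-monoˡ-≤ n (quotient-large N n)) ⟩
          A′ * (n * (q ∸ 1)) ^ n             ≡⟨ cong (A′ *_) (^-distribʳ-* n (q ∸ 1) n) ⟩
          A′ * (n ^ n * (q ∸ 1) ^ n)         ≡⟨ e₁ A′ (n ^ n) ((q ∸ 1) ^ n) ⟩
          A′ * (q ∸ 1) ^ n * n ^ n           ≤⟨ *-monoˡ-≤ (n ^ n) h ⟩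
          copies τ σ * (a ! * ls !ₗ) * n ^ n ≡⟨ e₂ (copies τ σ) (a !) (ls !ₗ) (n ^ n) ⟩
          copies τ σ * B                     ∎))))
    where
    open ≤-Reasoning
    instance
      n≢0 : NonZero n
      n≢0 = >-nonZero 1≤n
    q = N / n
    qn≤N : q * n ≤ N
    qn≤N = ≤-trans (m≤n+m (q * n) (N % n)) (≤-reflexive (sym (m≡m%n+[m/n]*n N n)))
    witness = copies-lower a ls {N = N} q pos eq qn≤N τ τ-layered
    σ = proj₁ witness
    h = proj₂ witness
    e₁ : ∀ x y z → x * (y * z) ≡ x * z * y
    e₁ = solve-∀
    e₂ : ∀ k x y z → k * (x * y) * z ≡ k * (z * x * y)
    e₂ = solve-∀

-- The largest density over hosts of length `N` is within `ε` of the claimed value when all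
-- densities stay below the upper margin and one exceeds the lower; this also yields the existence
-- of the limit.
mainTheorem1 : (a k : ℕ) (ℓ : Vec ℕ k) →
    2 ≤ a →
    (∀ (i : Fin k) → a ≤ lookup ℓ i) →
    (∀ (i j : Fin k) → i ≤ᶠ j → lookup ℓ i ≤ lookup ℓ j) →
    k + a + 1 ≤ 2 ^ a →
    (τ : Permutation′ (a + sumV ℓ)) →
    (∀ (i : Fin (a + sumV ℓ)) → toℕ (τ ⟨$⟩ʳ i) ≡ layeredFn (replicate a 1 ++ toList ℓ) (toℕ i)) →
    (ε : ℚ) → 0ℚ <ℚ ε →
    Σ ℕ (λ N₀ → (N : ℕ) → N₀ ≤ N →
    ((σ : Permutation′ N) →
    density τ σ <ℚ
    (frac ((a + sumV ℓ) ! * (a ^ a) * prodV (V.map (λ l → l ^ l) ℓ))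
    (((a + sumV ℓ) ^ (a + sumV ℓ)) * (a !) * prodV (V.map (λ l → l !) ℓ))
    +ℚ ε))
    × Σ (Permutation′ N) (λ σ →
    (frac ((a + sumV ℓ) ! * (a ^ a) * prodV (V.map (λ l → l ^ l) ℓ))
    (((a + sumV ℓ) ^ (a + sumV ℓ)) * (a !) * prodV (V.map (λ l → l !) ℓ))
    - ε) <ℚ density τ σ))
mainTheorem1 a k ℓ 2≤a a≤ sorted k≤ τ τ-layered ε ε>0 =
  subst₂ (λ x y → let α = frac (n ! * (a ^ a) * x) ((n ^ n) * (a !) * y) in
      Σ ℕ λ N₀ → (N : ℕ) → N₀ ≤ N →
        ((σ : Permutation′ N) → density τ σ <ℚ (α +ℚ ε)) × Σ (Permutation′ N) (λ σ → (α - ε) <ℚ density τ σ))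
    (product-toList (λ l → l ^ l) ℓ) (product-toList _! ℓ)
    (packing a (toList ℓ) (<⇒≤ 2≤a) (Sorted-toList ℓ sorted) (All-toList ℓ a≤) k≤excess
      (cong (a +_) (sum-toList ℓ)) τ τ-layered ε ε>0)
  where
  n = a + sumV ℓ
  k≤excess : length (toList ℓ) ≤ excess a
  k≤excess = subst (_≤ excess a) (sym (V.length-toList ℓ))
    (+-cancelʳ-≤ a _ _ (+-cancelʳ-≤ 1 _ _ (≤-trans k≤ (≤-reflexive (sym (excess-2^ a))))))
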